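{- Let $a,b,t$ be indeterminates, and let $n,k,r$ be integers with $0\le k\le n$ and $r\ge 0$. Then $$\delta_{n,k}=\sum_{j=k}^n (-1)^{j-k}\,\mathcal{G}_{a,b}(n,j;r)\,\mathcal{G}_{b,a}(j,k;r)$$ and $$\mathcal{G}_{a,b}(n,k;r)=\sum_{j=k}^n \mathcal{G}_{a,t}(n,j;r)\,\mathcal{G}_{ -t,b}(j,k;r),$$ where $\delta_{n,k}$ is the Kronecker delta.
   Context: Write $[m]=\{1,\ldots,m\}$, $[0]=\varnothing$. A Lah distribution of $[m]$ into $\ell$ blocks is a partition of $[m]$ into $\ell$ non-empty, pairwise disjoint blocks in which the elements within each block are linearly ordered (the blocks themselves are not ordered). For integers $n,k,r$ with $0\le k\le n$ and $r\ge 0$, let $\mathcal{L}_r(n,k)$ be the set of Lah distributions of $[n+r]$ into $k+r$ blocks in which the elements of $[r]$ belong to distinct blocks. An element $i$ of a Lah distribution $\lambda$ is a record low if there is no element $j<i$ to the left of $i$ within its block. Let $rec^*(\lambda)$ be the number of record lows of $\lambda$ that are not the smallest element of their block, and let $nrec(\lambda)$ be the number of elements of the underlying set that are not record lows of $\lambda$. The generalized $r$-Lah number is the polynomial in indeterminates $a,b$ $$\mathcal{G}_{a,b}(n,k;r)=\sum_{\lambda\in\mathcal{L}_r(n,k)}a^{nrec(\lambda)}b^{rec^*(\lambda)},$$ with $\mathcal{G}_{a,b}(n,k;r)=0$ unless $0\le k\le n$ and $r\ge 0$. For other subscripts, $\mathcal{G}_{u,v}(n,k;r)$ denotes the result of substituting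 $a=u$, $b=v$ in this polynomial. -}

module Defs where

open import Algebra.Bundles using (CommutativeRing)
open import Data.Bool.Base using (if_then_else_)
open import Data.Fin.Base using (zero; suc)
open import Data.Fin.Properties using (injective⇒≤)
open import Data.List.Base
  using (List; _++_; []; _∷_; length; map; foldr; filter; concat; applyUpTo;
         takeWhile; cartesianProductWith; lookup)
open import Data.List.Membership.DecPropositional using (_∈?_)
open import Data.List.Membership.Propositional using (_∈_)
open import Data.List.Membership.Propositional.Properties
  using (∈-filter⁺; ∈-filter⁻; ∈-cartesianProductWith⁺; ∈-cartesianProductWith⁻;
         ∈-concat⁺′; ∈-map⁺; ∈-applyUpTo⁺; ∈-lookup)
open import Data.List.Properties using (∷-injective; length-applyUpTo)
open import Data.List.Relation.Binary.Disjoint.Propositional using (Disjoint)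
open import Data.List.Relation.Unary.All as All using (All; all?; []; _∷_)
import Data.List.Relation.Unary.All.Properties as All
open import Data.List.Relation.Unary.AllPairs as AllPairs using (AllPairs; allPairs?; []; _∷_)
import Data.List.Relation.Unary.AllPairs.Properties as AllPairs
open import Data.List.Relation.Unary.Any as Any using (Any; any?; here; there)
open import Data.List.Relation.Unary.Any.Properties using (lookup-index)
open import Data.List.Relation.Unary.Unique.DecPropositional using (unique?)
open import Data.List.Relation.Unary.Unique.Propositional using (Unique)
import Data.List.Relation.Unary.Unique.Propositional.Properties as Unique
open import Data.Nat.Base using (ℕ; zero; suc; _+_; _∸_; _≤_; _<_; s≤s)
import Data.Nat.ListAction as List
open import Data.Nat.Properties
  using (_≟_; _≤?_; _<?_; +-cancelˡ-≡; <⇒≢; ≤-trans; ≤-reflexive)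
open import Data.Product.Base using (_×_; _,_; proj₁; proj₂)
open import Function.Base using (_∘_)
open import Function.Bundles using (_⇔_; mk⇔)
open import Relation.Binary.PropositionalEquality
  using (_≡_; _≢_; refl; sym; trans; cong; subst)
open import Relation.Nullary.Decidable
  using (Dec; yes; no; does; ¬?; _×-dec_; _→-dec_; map′)
open import Relation.Nullary.Negation using (¬_; contradiction)

-- [ lo ⋯ hi ] lists lo, lo + 1, …, hi in order; it is empty when hi < lo.
[_⋯_] : ℕ → ℕ → List ℕ
[ lo ⋯ hi ] = applyUpTo (lo +_) (suc hi ∸ lo)

-- A block is the word of its elements, read from left to right.
Block : Set
Block = List ℕ

Smallest : Block → ℕ → Set
Smallest B i = All (i ≤_) B

smallest? : ∀ B i → Dec (Smallest B i)
smallest? B i = all? (i ≤?_) B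

-- For non-empty blocks: the minimum of B is less than the minimum of C.
_≺_ : Block → Block → Set
B ≺ C = Any (λ i → All (i <_) C) B

_≺?_ : ∀ B C → Dec (B ≺ C)
B ≺? C = any? (λ i → all? (i <?_) C) B

-- Lah distributions of [m] into ℓ blocks with the elements of [r] in distinct
-- blocks.  The blocks of a distribution form an unordered collection, and each
-- such collection is represented exactly once, by listing its blocks in
-- increasing order of their minima.  Duplicate-freeness of the concatenation
-- says both that no block repeats an element and that distinct blocks are
-- disjoint.
record IsLahDistribution (r m ℓ : ℕ) (bs : List Block) : Set where
  field
    numberOfBlocks : length bs ≡ ℓ
    nonEmpty       : All (_≢ []) bs
    disjoint       : Unique (concat bs)
    withinGround   : All (_∈ [ 1 ⋯ m ]) (concat bs)
    coversGround   : All (_∈ concat bs) [ 1 ⋯ m ]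
    separated      : All (λ B → All (λ i → All (λ j → i ≤ r → j ≤ r → i ≡ j) B) B) bs
    canonicalOrder : AllPairs _≺_ bs

isLahDistribution? : ∀ r m ℓ bs → Dec (IsLahDistribution r m ℓ bs)
isLahDistribution? r m ℓ bs = map′
  (λ (p₁ , p₂ , p₃ , p₄ , p₅ , p₆ , p₇) → record
    { numberOfBlocks = p₁ ; nonEmpty = p₂ ; disjoint = p₃ ; withinGround = p₄
    ; coversGround = p₅ ; separated = p₆ ; canonicalOrder = p₇ })
  (λ d → let open IsLahDistribution d in
    numberOfBlocks , nonEmpty , disjoint , withinGround
    , coversGround , separated , canonicalOrder)
  (       (length bs ≟ ℓ)
    ×-dec all? (λ B → ¬? (≡[]? B)) bs
    ×-dec unique? _≟_ (concat bs)
    ×-dec all? (λ i → _∈?_ _≟_ i [ 1 ⋯ m ]) (concat bs)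
    ×-dec all? (λ i → _∈?_ _≟_ i (concat bs)) [ 1 ⋯ m ]
    ×-dec all? (λ B → all? (λ i → all? (λ j →
            (i ≤? r) →-dec ((j ≤? r) →-dec (i ≟ j))) B) B) bs
    ×-dec allPairs? _≺?_ bs)
  where
  ≡[]? : (B : Block) → Dec (B ≡ [])
  ≡[]? []      = yes refl
  ≡[]? (_ ∷ _) = no λ ()

words : ∀ {A : Set} → List A → ℕ → List (List A)
words xs zero    = [] ∷ []
words xs (suc n) = cartesianProductWith _∷_ xs (words xs n)

-- A finite search space: sequences of ℓ words, each of length at most m, over
-- the alphabet [m].
candidates : ℕ → ℕ → List (List Block)
candidates m ℓ = words (concat (map (words [ 1 ⋯ m ]) [ 0 ⋯ m ])) ℓ

-- The set 𝓛ᵣ(n,k) as a list.  That it contains every distribution, and each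
-- exactly once, is ∈-𝓛 and 𝓛-unique below.
𝓛 : (r n k : ℕ) → List (List Block)
𝓛 r n k = filter (isLahDistribution? r (n + r) (k + r)) (candidates (n + r) (k + r))

-- The elements to the left of i in B (all of B if i does not occur in B).
leftOf : ℕ → Block → Block
leftOf i B = takeWhile (λ j → ¬? (j ≟ i)) B

RecordLow : Block → ℕ → Set
RecordLow B i = All (λ j → ¬ (j < i)) (leftOf i B)

recordLow? : ∀ B i → Dec (RecordLow B i)
recordLow? B i = all? (λ j → ¬? (j <? i)) (leftOf i B)

rec* : List Block → ℕ
rec* bs = List.sum (map (λ B → length (filter (λ i → recordLow? B i ×-dec ¬? (smallest? B i)) B)) bs)

nrec : List Block → ℕ
nrec bs = List.sum (map (λ B → length (filter (λ i → ¬? (recordLow? B i)) B)) bs)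

-- Identities between polynomials with integer coefficients are expressed by
-- their values at arbitrary elements of an arbitrary commutative ring;
-- 𝒢 u v n k r is the value of the generalized r-Lah polynomial at a = u, b = v.
module GeneralizedLah {c ℓ} (R : CommutativeRing c ℓ) where
  open CommutativeRing R using (Carrier; 0#; 1#; _*_; semiring) renaming (_+_ to _+ᴿ_)
  open import Algebra.Properties.Semiring.Exp semiring public using (_^_)

  ∑ : ∀ {A : Set} → List A → (A → Carrier) → Carrier
  ∑ xs f = foldr _+ᴿ_ 0# (map f xs)

  infix 5 ∑
  syntax ∑ xs (λ x → e) = ∑[ x ∈ xs ] e

  𝒢 : (u v : Carrier) (n k r : ℕ) → Carrier
  𝒢 u v n k r = ∑[ bs ∈ 𝓛 r n k ] u ^ nrec bs * v ^ rec* bs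

  δ : ℕ → ℕ → Carrier
  δ n k = if does (n ≟ k) then 1# else 0#

private
  words⁺ : ∀ {A : Set} {xs : List A} ws → All (_∈ xs) ws → ws ∈ words xs (length ws)
  words⁺ []       []       = here refl
  words⁺ (w ∷ ws) (p ∷ ps) = ∈-cartesianProductWith⁺ _∷_ p (words⁺ ws ps)

  words-length : ∀ {A : Set} (xs : List A) n {ws} → ws ∈ words xs n → length ws ≡ n
  words-length xs zero    (here refl) = refl
  words-length xs (suc n) p
    with _ , _ , _ , q , refl ← ∈-cartesianProductWith⁻ _∷_ xs (words xs n) p
    = cong suc (words-length xs n q)

  words-unique : ∀ {A : Set} {xs : List A} n → Unique xs → Unique (words xs n)
  words-unique zero    u = [] ∷ []
  words-unique (suc n) u = Unique.cartesianProductWith⁺ _∷_ ∷-injective u (words-unique n u)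

  interval-unique : ∀ lo hi → Unique [ lo ⋯ hi ]
  interval-unique lo hi =
    Unique.applyUpTo⁺₁ (lo +_) (suc hi ∸ lo) λ i<j _ → <⇒≢ i<j ∘ +-cancelˡ-≡ lo _ _

  blocks-unique : ∀ {A : Set} {xs : List A} {ns} → Unique xs → Unique ns →
                  Unique (concat (map (words xs) ns))
  blocks-unique {A} {xs} u v = Unique.concat⁺
    (All.map⁺ (All.universal (λ n → words-unique n u) _))
    (AllPairs.map⁺ (AllPairs.map disjointWords v))
    where
    disjointWords : ∀ {i j} → i ≢ j → Disjoint (words xs i) (words xs j)
    disjointWords {i} {j} i≢j (p , q) =
      i≢j (trans (sym (words-length xs i p)) (words-length xs j q))

  candidates-unique : ∀ m ℓ → Unique (candidates m ℓ)
  candidates-unique m ℓ =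
    words-unique ℓ (blocks-unique (interval-unique 1 m) (interval-unique 0 m))

  lookup-injective : ∀ {A : Set} {xs : List A} → Unique xs →
                     ∀ i j → lookup xs i ≡ lookup xs j → i ≡ j
  lookup-injective {xs = _ ∷ xs} (x∉ ∷ u) zero    zero    eq = refl
  lookup-injective {xs = _ ∷ xs} (x∉ ∷ u) zero    (suc j) eq = contradiction eq (All.lookup x∉ (∈-lookup j))
  lookup-injective {xs = _ ∷ xs} (x∉ ∷ u) (suc i) zero    eq = contradiction (sym eq) (All.lookup x∉ (∈-lookup i))
  lookup-injective {xs = _ ∷ xs} (x∉ ∷ u) (suc i) (suc j) eq = cong suc (lookup-injective u i j eq)

  length-≤ : ∀ {A : Set} {xs ys : List A} → Unique xs → All (_∈ ys) xs → length xs ≤ length ys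
  length-≤ {xs = xs} {ys} u ps = injective⇒≤ {f = Any.index ∘ p} inj
    where
    p : ∀ i → lookup xs i ∈ ys
    p i = All.lookup ps (∈-lookup i)
    inj : ∀ {i j} → Any.index (p i) ≡ Any.index (p j) → i ≡ j
    inj {i} {j} eq = lookup-injective u i j
      (trans (lookup-index (p i)) (trans (cong (lookup ys) eq) (sym (lookup-index (p j)))))

  unique-++ : ∀ {A : Set} (xs : List A) {ys} → Unique (xs ++ ys) → Unique xs × Unique ys
  unique-++ []       u       = [] , u
  unique-++ (x ∷ xs) (p ∷ u) =
    All.++⁻ˡ xs p ∷ proj₁ (unique-++ xs u) , proj₂ (unique-++ xs u)

  unique-concat : ∀ {A : Set} (xss : List (List A)) → Unique (concat xss) → All Unique xss
  unique-concat []         u = []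
  unique-concat (xs ∷ xss) u =
    proj₁ (unique-++ xs u) ∷ unique-concat xss (proj₂ (unique-++ xs u))

  ∈-candidates : ∀ {r m ℓ bs} → IsLahDistribution r m ℓ bs → bs ∈ candidates m ℓ
  ∈-candidates {m = m} {bs = bs} d = subst (λ ℓ → bs ∈ candidates m ℓ) numberOfBlocks
    (words⁺ bs (All.zipWith block∈ (unique-concat bs disjoint , All.concat⁻ withinGround)))
    where
    open IsLahDistribution d
    block∈ : ∀ {B} → Unique B × All (_∈ [ 1 ⋯ m ]) B →
             B ∈ concat (map (words [ 1 ⋯ m ]) [ 0 ⋯ m ])
    block∈ {B} (u , ps) = ∈-concat⁺′ (words⁺ B ps)
      (∈-map⁺ (words [ 1 ⋯ m ]) (∈-applyUpTo⁺ (0 +_) (s≤s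
        (≤-trans (length-≤ u ps) (≤-reflexive (length-applyUpTo (1 +_) m))))))

∈-𝓛 : ∀ {r n k bs} → bs ∈ 𝓛 r n k ⇔ IsLahDistribution r (n + r) (k + r) bs
∈-𝓛 {r} {n} {k} = mk⇔
  (λ p → proj₂ (∈-filter⁻ (isLahDistribution? r (n + r) (k + r))
                  {xs = candidates (n + r) (k + r)} p))
  (λ d → ∈-filter⁺ (isLahDistribution? r (n + r) (k + r)) (∈-candidates d) d)

𝓛-unique : ∀ r n k → Unique (𝓛 r n k)
𝓛-unique r n k = Unique.filter⁺ (isLahDistribution? r (n + r) (k + r))
  (candidates-unique (n + r) (k + r))

{-# OPTIONS --safe #-}

-- Inserting the largest element n + 1 + r into a Lah distribution of [n + r]
-- creates a new last block, or a record low that is not minimal (at the front of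
-- one of the k + r blocks), or an element that is not a record low (after one of
-- the n + r elements); nothing else changes.  Hence
--   𝒢 u v (n+1) k = 𝒢 u v n (k-1) + ((n+r) u + (k+r) v) 𝒢 u v n k.
-- In a product of the triangles for (a, t) and (- t, b) the two occurrences of
-- (j+r) t cancel, so the product satisfies the recurrence for (a, b).  Taking
-- (a, b) and (- b, - a) gives 𝒢 a (- a), whose coefficient (n - k) a vanishes on
-- the diagonal, so it is the identity; by homogeneity negating both parameters
-- gives the sign (-1)^(j-k).
module Submission where

open import Defs
open import Algebra.Bundles using (CommutativeRing)
open import Data.Bool.Base using (true; false)
open import Data.List.Base
  using (List; []; _∷_; [_]; _++_; _∷ʳ_; length; map; foldr; concat; concatMap; filter;
         takeWhile; applyUpTo; upTo)
open import Data.List.Membership.Propositional using (_∈_; _∉_; find; lose)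
open import Data.List.Membership.Propositional.Properties
  using (∈-map⁺; ∈-map⁻; ∈-++⁺ˡ; ∈-++⁺ʳ; ∈-++⁻; ∈-∃++; ∈-concatMap⁺; ∈-concatMap⁻)
open import Data.List.Membership.Propositional.Properties.WithK using (unique∧set⇒bag)
open import Data.List.Properties
  using (length-applyUpTo; length-map; length-++; applyUpTo-∷ʳ; upTo-∷ʳ; map-applyUpTo; map-upTo;
         map-++; map-∘; concat-++; filter-accept; filter-reject; filter-++; filter-all;
         ∷-injectiveˡ; ∷-injectiveʳ; ∷ʳ-injectiveˡ)
open import Data.List.Relation.Binary.BagAndSetEquality using (∼bag⇒↭)
open import Data.List.Relation.Binary.Disjoint.Propositional using (Disjoint)
open import Data.List.Relation.Binary.Permutation.Propositional
  using (_↭_; prep; swap; ↭-refl; ↭-reflexive; ↭-sym; ↭-trans; ↭⇒↭ₛ)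
open import Data.List.Relation.Binary.Permutation.Propositional.Properties
  using (shift; ++⁺ˡ; ++⁺ʳ; drop-∷; ∷↭∷ʳ; ↭-length; ∈-resp-↭; All-resp-↭; Any-resp-↭)
import Data.List.Relation.Binary.Permutation.Setoid.Properties as PermutationSetoid
open import Data.List.Relation.Unary.All as All using (All; []; _∷_)
import Data.List.Relation.Unary.All.Properties as All
open import Data.List.Relation.Unary.AllPairs using (AllPairs; []; _∷_)
import Data.List.Relation.Unary.AllPairs.Properties as AllPairs
open import Data.List.Relation.Unary.Any as Any using (here; there)
open import Data.List.Relation.Unary.Unique.Propositional using (Unique)
import Data.List.Relation.Unary.Unique.Propositional.Properties as Unique
open import Data.Nat.Base
  using (ℕ; zero; suc; _∸_; _≤_; _<_; s≤s; z<s; s<s) renaming (_+_ to _+ℕ_)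
open import Data.Nat.Properties
  using (_≟_; _≤?_; _<?_; ≤-refl; ≤-trans; ≤-pred; <⇒≤; <⇒≢; <⇒≱; <⇒≯; ≮⇒≥; <-irrefl; m≤n+m;
         m≤n⇒m≤1+n; m<n⇒m<1+n; +-suc; +-∸-assoc; m+[n∸m]≡n; suc-injective)
open import Data.Product.Base using (_×_; _,_; proj₁; proj₂; ∃-syntax; ∃₂)
open import Data.Sum.Base using (inj₁; inj₂)
open import Function.Base using (_∘_; id)
open import Function.Bundles using (_⇔_; mk⇔; Equivalence)
open import Relation.Binary.PropositionalEquality as ≡
  using (_≡_; _≢_; cong; cong₂; subst)
open import Relation.Nullary.Decidable using (does; yes; no; ¬?; _×-dec_; dec-true; dec-false)
open import Relation.Nullary.Negation using (¬_; contradiction)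
open import Relation.Unary using (Decidable)

-- Lah distributions and their ground sets

module LahDistributions where
  open ≡ using (refl; sym; trans)
  open Data.Nat.Base using (_+_)

  private variable
    A : Set
    r m ℓ x i : ℕ
    B C D : Block
    bs cs : List Block

  -- Membership in a duplicate-free list has at most one proof, so equality as sets is already
  -- equality as bags. This reduces each recurrence for `𝓛` to two membership implications.
  unique∧set⇒↭ : {xs ys : List A} → Unique xs → Unique ys →
                 (∀ {z} → z ∈ xs → z ∈ ys) → (∀ {z} → z ∈ ys → z ∈ xs) → xs ↭ ys
  unique∧set⇒↭ u v f g = ∼bag⇒↭ (unique∧set⇒bag u v (mk⇔ f g))

  interval-∷ʳ : ∀ m → [ 1 ⋯ suc m ] ↭ suc m ∷ [ 1 ⋯ m ]
  interval-∷ʳ m = ↭-trans (↭-reflexive (sym (applyUpTo-∷ʳ suc m))) (↭-sym (∷↭∷ʳ _ _))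

  interval-≤ : ∀ m → All (_≤ m) [ 1 ⋯ m ]
  interval-≤ m = All.applyUpTo⁺₁ suc m id

  interval-unique : ∀ m → Unique [ 1 ⋯ m ]
  interval-unique m = Unique.applyUpTo⁺₁ suc m λ i<j _ → <⇒≢ i<j ∘ suc-injective

  Separated : ℕ → Block → Set
  Separated r B = All (λ i → All (λ j → i ≤ r → j ≤ r → i ≡ j) B) B

  -- IsLahDistribution with its three ground-set conditions merged into one.
  record Lah (r m ℓ : ℕ) (bs : List Block) : Set where
    field
      count     : length bs ≡ ℓ
      nonEmpty  : All (_≢ []) bs
      ground    : concat bs ↭ [ 1 ⋯ m ]
      separated : All (Separated r) bs
      canonical : AllPairs _≺_ bs

    bounded : All (All (_≤ m)) bs
    bounded = All.concat⁻ (All-resp-↭ (↭-sym ground) (interval-≤ m))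

    bounded< : All (All (_< suc m)) bs
    bounded< = All.map (All.map s≤s) bounded

    size : length (concat bs) ≡ m
    size = trans (↭-length ground) (length-applyUpTo suc m)

  Lah⇔ : IsLahDistribution r m ℓ bs ⇔ Lah r m ℓ bs
  Lah⇔ {m = m} = mk⇔
    (λ d → let open IsLahDistribution d in record
      { count = numberOfBlocks ; nonEmpty = nonEmpty ; separated = separated
      ; canonical = canonicalOrder
      ; ground = unique∧set⇒↭ disjoint (interval-unique m)
          (All.lookup withinGround) (All.lookup coversGround) })
    (λ d → let open Lah d in record
      { numberOfBlocks = count ; nonEmpty = nonEmpty ; separated = separated
      ; canonicalOrder = canonical
      ; disjoint = PermutationSetoid.Unique-resp-↭ (≡.setoid ℕ) (↭⇒↭ₛ (↭-sym ground)) (interval-unique m)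
      ; withinGround = All.tabulate (∈-resp-↭ ground)
      ; coversGround = All.tabulate (∈-resp-↭ (↭-sym ground)) })

  -- Insertion of the largest element

  inserts : ℕ → Block → List Block
  inserts x []      = [ [ x ] ]
  inserts x (y ∷ B) = (x ∷ y ∷ B) ∷ map (y ∷_) (inserts x B)

  ∈-inserts⁺ : ∀ ps {qs} → ps ++ x ∷ qs ∈ inserts x (ps ++ qs)
  ∈-inserts⁺ []       {[]}    = here refl
  ∈-inserts⁺ []       {_ ∷ _} = here refl
  ∈-inserts⁺ (p ∷ ps)         = there (∈-map⁺ (p ∷_) (∈-inserts⁺ ps))

  ∈-inserts⁻ : ∀ B → C ∈ inserts x B → ∃₂ λ ps qs → B ≡ ps ++ qs × C ≡ ps ++ x ∷ qs
  ∈-inserts⁻ []      (here refl) = [] , [] , refl , refl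
  ∈-inserts⁻ (y ∷ B) (here refl) = [] , y ∷ B , refl , refl
  ∈-inserts⁻ (y ∷ B) (there p)
    with _ , q , refl ← ∈-map⁻ (y ∷_) p
    with ps , qs , refl , refl ← ∈-inserts⁻ B q
    = y ∷ ps , qs , refl , refl

  inserts-↭ : ∀ B → C ∈ inserts x B → C ↭ x ∷ B
  inserts-↭ B p with ps , qs , refl , refl ← ∈-inserts⁻ B p = shift _ ps qs

  inserts-unique : ∀ B → x ∉ B → Unique (inserts x B)
  inserts-unique []      x∉ = [] ∷ []
  inserts-unique (y ∷ B) x∉ =
    All.map⁺ (All.universal (λ _ eq → x∉ (here (∷-injectiveˡ eq))) _)
    ∷ Unique.map⁺ ∷-injectiveʳ (inserts-unique B (x∉ ∘ there))

  length-inserts : ∀ x B → length (inserts x B) ≡ suc (length B)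
  length-inserts x []      = refl
  length-inserts x (y ∷ B) = cong suc (trans (length-map (y ∷_) (inserts x B)) (length-inserts x B))

  -- An inductive form of membership in `extensions`: the conditions on a distribution are
  -- transferred by induction on the block that receives `x`.
  data Extension (x : ℕ) : List Block → List Block → Set where
    here  : C ∈ inserts x B → Extension x (B ∷ bs) (C ∷ bs)
    there : Extension x bs cs → Extension x (B ∷ bs) (B ∷ cs)

  extensions : ℕ → List Block → List (List Block)
  extensions x []       = []
  extensions x (B ∷ bs) = map (_∷ bs) (inserts x B) ++ map (B ∷_) (extensions x bs)

  ∈-extensions⁺ : Extension x bs cs → cs ∈ extensions x bs
  ∈-extensions⁺ (here p)  = ∈-++⁺ˡ (∈-map⁺ _ p)
  ∈-extensions⁺ (there e) = ∈-++⁺ʳ _ (∈-map⁺ _ (∈-extensions⁺ e))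

  ∈-extensions⁻ : ∀ bs → cs ∈ extensions x bs → Extension x bs cs
  ∈-extensions⁻ {x = x} (B ∷ bs) p with ∈-++⁻ (map (_∷ bs) (inserts x B)) p
  ... | inj₁ q with _ , q′ , refl ← ∈-map⁻ _ q = here q′
  ... | inj₂ q with _ , q′ , refl ← ∈-map⁻ _ q = there (∈-extensions⁻ bs q′)

  -- The conditions on a distribution under extension

  extension-concat : Extension x bs cs → concat cs ↭ x ∷ concat bs
  extension-concat {bs = B ∷ bs} (here p)  = ++⁺ʳ (concat bs) (inserts-↭ B p)
  extension-concat {bs = B ∷ bs} (there e) =
    ↭-trans (++⁺ˡ B (extension-concat e)) (shift _ B (concat bs))

  extension-length : Extension x bs cs → length cs ≡ length bs
  extension-length (here _)  = refl
  extension-length (there e) = cong suc (extension-length e)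

  inserts-nonEmpty : ∀ B → C ∈ inserts x B → C ≢ []
  inserts-nonEmpty B p with ∈-inserts⁻ B p
  ... | []    , _ , _ , refl = λ ()
  ... | _ ∷ _ , _ , _ , refl = λ ()

  extension-nonEmpty : Extension x bs cs → All (_≢ []) bs → All (_≢ []) cs
  extension-nonEmpty (here {B = B} p) (_ ∷ ne) = inserts-nonEmpty B p ∷ ne
  extension-nonEmpty (there e) (n ∷ ne)        = n ∷ extension-nonEmpty e ne

  -- The condition concerns only elements up to `r`, and the new element `x` lies above `r`.
  Separated-insert⁺ : r < x → C ↭ x ∷ B → Separated r B → Separated r C
  Separated-insert⁺ r<x p s = All.tabulate λ i∈ → All.tabulate λ j∈ →
    go (∈-resp-↭ p i∈) (∈-resp-↭ p j∈)
    where
    go : ∀ {i j} → i ∈ _ → j ∈ _ → i ≤ _ → j ≤ _ → i ≡ j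
    go (here refl) _           i≤r _   = contradiction i≤r (<⇒≱ r<x)
    go (there _)   (here refl) _   j≤r = contradiction j≤r (<⇒≱ r<x)
    go (there i∈)  (there j∈)          = All.lookup (All.lookup s i∈) j∈

  Separated-insert⁻ : C ↭ x ∷ B → Separated r C → Separated r B
  Separated-insert⁻ p s with _ ∷ s′ ← All-resp-↭ p (All.map (All-resp-↭ p) s) = All.map All.tail s′

  extension-separated⁺ : r < x → Extension x bs cs → All (Separated r) bs → All (Separated r) cs
  extension-separated⁺ r<x (here {B = B} p) (s ∷ ss) = Separated-insert⁺ r<x (inserts-↭ B p) s ∷ ss
  extension-separated⁺ r<x (there e)        (s ∷ ss) = s ∷ extension-separated⁺ r<x e ss

  extension-separated⁻ : Extension x bs cs → All (Separated r) cs → All (Separated r) bs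
  extension-separated⁻ (here {B = B} p) (s ∷ ss) = Separated-insert⁻ (inserts-↭ B p) s ∷ ss
  extension-separated⁻ (there e)        (s ∷ ss) = s ∷ extension-separated⁻ e ss

  -- The block that receives `x` already holds some `y < x`. If `x ≤ r`, then both would be elements
  -- of [r] in one block, against separation.
  extension⇒< : Extension x bs cs → All (_≢ []) bs → All (All (_< x)) bs → All (Separated r) cs → r < x
  extension⇒< (there e) (_ ∷ ne) (_ ∷ lt) (_ ∷ ss) = extension⇒< e ne lt ss
  extension⇒< (here {B = []} _) (n ∷ _) _ _ = contradiction refl n
  extension⇒< {x} {r = r} (here {B = y ∷ B} p) _ ((y<x ∷ _) ∷ _) (s ∷ _) with suc r ≤? x
  ... | yes r<x = r<x
  ... | no  r≮x
    with ((_ ∷ eq ∷ _) ∷ _) ← All-resp-↭ (inserts-↭ (y ∷ B) p) (All.map (All-resp-↭ (inserts-↭ (y ∷ B) p)) s)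
    = contradiction (sym (eq x≤r (≤-trans (<⇒≤ y<x) x≤r))) (<⇒≢ y<x)
    where
    x≤r : x ≤ r
    x≤r = ≮⇒≥ r≮x

  -- The canonical order under insertion of a maximum

  ≺-insertˡ⁺ : C ↭ x ∷ B → B ≺ D → C ≺ D
  ≺-insertˡ⁺ p q = Any-resp-↭ (↭-sym p) (there q)

  -- The witness of `B ≺ D` is an element of `B`, hence also below `x`.
  ≺-insertʳ⁺ : All (_< x) B → C ↭ x ∷ D → B ≺ D → B ≺ C
  ≺-insertʳ⁺ lt p q with _ , i∈ , h ← find q =
    lose i∈ (All-resp-↭ (↭-sym p) (All.lookup lt i∈ ∷ h))

  ¬max< : D ≢ [] → All (_≤ x) D → ¬ All (x <_) D
  ¬max< n []       []       = n refl
  ¬max< n (le ∷ _) (lt ∷ _) = <⇒≱ lt le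

  -- The witness of `C ≺ D` cannot be `x` itself, because the non-empty block `D` has no element
  -- above `x`; so it lies in `B`.
  ≺-insertˡ⁻ : D ≢ [] → All (_≤ x) D → C ↭ x ∷ B → C ≺ D → B ≺ D
  ≺-insertˡ⁻ n le p q with Any-resp-↭ p q
  ... | here lt = contradiction lt (¬max< n le)
  ... | there q = q

  ≺-insertʳ⁻ : C ↭ x ∷ D → B ≺ C → B ≺ D
  ≺-insertʳ⁻ p = Any.map λ h → All.tail (All-resp-↭ p h)

  -- A new maximum changes the minimum of no non-empty block. The local `go` handles an insertion
  -- into a block later than the one being compared.
  extension-canonical⁺ : Extension x bs cs → All (All (_< x)) bs → AllPairs _≺_ bs → AllPairs _≺_ cs
  extension-canonical⁺ (here {B = B} p) _ (o ∷ os) = All.map (≺-insertˡ⁺ (inserts-↭ B p)) o ∷ os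
  extension-canonical⁺ {x} (there e) (lt ∷ lts) (o ∷ os) = go e o ∷ extension-canonical⁺ e lts os
    where
    go : ∀ {bs cs} → Extension x bs cs → All (_ ≺_) bs → All (_ ≺_) cs
    go (here {B = D} p) (o ∷ os) = ≺-insertʳ⁺ lt (inserts-↭ D p) o ∷ os
    go (there e)        (o ∷ os) = o ∷ go e os

  extension-canonical⁻ : Extension x bs cs → All (_≢ []) cs → All (All (_≤ x)) cs →
                         AllPairs _≺_ cs → AllPairs _≺_ bs
  extension-canonical⁻ (here {B = B} p) (_ ∷ ne) (_ ∷ le) (o ∷ os) =
    All.zipWith (λ (n , l , o) → ≺-insertˡ⁻ n l (inserts-↭ B p) o) (ne , All.zip (le , o)) ∷ os
  extension-canonical⁻ {x} (there e) (_ ∷ ne) (_ ∷ le) (o ∷ os) = go e o ∷ extension-canonical⁻ e ne le os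
    where
    go : ∀ {bs cs} → Extension x bs cs → All (_ ≺_) cs → All (_ ≺_) bs
    go (here {B = D} p) (o ∷ os) = ≺-insertʳ⁻ (inserts-↭ D p) o ∷ os
    go (there e)        (o ∷ os) = o ∷ go e os

  Lah-extension⁺ : r ≤ m → Extension (suc m) bs cs → Lah r m ℓ bs → Lah r (suc m) ℓ cs
  Lah-extension⁺ {m = m} r≤m e d = record
    { count = trans (extension-length e) count
    ; nonEmpty = extension-nonEmpty e nonEmpty
    ; ground = ↭-trans (extension-concat e) (↭-trans (prep _ ground) (↭-sym (interval-∷ʳ m)))
    ; separated = extension-separated⁺ (s≤s r≤m) e separated
    ; canonical = extension-canonical⁺ e bounded< canonical }
    where open Lah d

  -- Since `inserts x []` also yields `[ x ]`, an extension alone does not prevent removal of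
  -- `suc m` from leaving an empty block; the hypothesis on `bs` excludes this.
  Lah-extension⁻ : Extension (suc m) bs cs → All (_≢ []) bs → Lah r (suc m) ℓ cs → Lah r m ℓ bs
  Lah-extension⁻ {m = m} e ne d = record
    { count = trans (sym (extension-length e)) count
    ; nonEmpty = ne
    ; ground = drop-∷ (↭-trans (↭-sym (extension-concat e)) (↭-trans ground (interval-∷ʳ m)))
    ; separated = extension-separated⁻ e separated
    ; canonical = extension-canonical⁻ e nonEmpty bounded canonical }
    where open Lah d

  -- Appending the largest element as a block of its own

  concat-∷ʳ : ∀ (bs : List Block) x → concat (bs ∷ʳ [ x ]) ≡ concat bs ∷ʳ x
  concat-∷ʳ bs x = sym (concat-++ bs [ [ x ] ])

  length-∷ʳ : ∀ (bs : List Block) B → length (bs ∷ʳ B) ≡ suc (length bs)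
  length-∷ʳ []       B = refl
  length-∷ʳ (_ ∷ bs) B = cong suc (length-∷ʳ bs B)

  concat-∷ʳ-↭ : ∀ (bs : List Block) x → concat (bs ∷ʳ [ x ]) ↭ x ∷ concat bs
  concat-∷ʳ-↭ bs x = ↭-trans (↭-reflexive (concat-∷ʳ bs x)) (↭-sym (∷↭∷ʳ x (concat bs)))

  ≺-max : B ≢ [] → All (_< x) B → B ≺ [ x ]
  ≺-max n []       = contradiction refl n
  ≺-max n (lt ∷ _) = here (lt ∷ [])

  -- The block `[ suc m ]` has the largest minimum, so the canonical order puts it last. It cannot
  -- violate separation, having one element only.
  Lah-∷ʳ⁺ : Lah r m ℓ bs → Lah r (suc m) (suc ℓ) (bs ∷ʳ [ suc m ])
  Lah-∷ʳ⁺ {m = m} {bs = bs} d = record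
    { count = trans (length-∷ʳ bs _) (cong suc count)
    ; nonEmpty = All.∷ʳ⁺ nonEmpty λ ()
    ; ground = ↭-trans (concat-∷ʳ-↭ bs _) (↭-trans (prep _ ground) (↭-sym (interval-∷ʳ m)))
    ; separated = All.∷ʳ⁺ separated (((λ _ _ → refl) ∷ []) ∷ [])
    ; canonical = AllPairs.++⁺ canonical ([] ∷ [])
        (All.zipWith (λ (n , lt) → ≺-max n lt ∷ []) (nonEmpty , bounded<)) }
    where open Lah d

  AllPairs-∷ʳ⁻ : ∀ bs → AllPairs _≺_ (bs ∷ʳ B) → AllPairs _≺_ bs
  AllPairs-∷ʳ⁻ []       _        = []
  AllPairs-∷ʳ⁻ (_ ∷ bs) (o ∷ os) = proj₁ (All.∷ʳ⁻ o) ∷ AllPairs-∷ʳ⁻ bs os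

  Lah-∷ʳ⁻ : Lah r (suc m) ℓ (bs ∷ʳ [ suc m ]) → ∃[ ℓ′ ] ℓ ≡ suc ℓ′ × Lah r m ℓ′ bs
  Lah-∷ʳ⁻ {m = m} {bs = bs} d = length bs , trans (sym count) (length-∷ʳ bs _) , record
    { count = refl
    ; nonEmpty = proj₁ (All.∷ʳ⁻ nonEmpty)
    ; ground = drop-∷ (↭-trans (↭-sym (concat-∷ʳ-↭ bs _)) (↭-trans ground (interval-∷ʳ m)))
    ; separated = proj₁ (All.∷ʳ⁻ separated)
    ; canonical = AllPairs-∷ʳ⁻ bs canonical }
    where open Lah d

  -- The two origins of a distribution

  data Origin (x : ℕ) : List Block → Set where
    inserted : Extension x bs cs → All (_≢ []) bs → Origin x cs
    appended : ∀ bs → Origin x (bs ∷ʳ [ x ])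

  -- The block that contains `x` either has another element, and then deleting `x` leaves it
  -- non-empty, or is `[ x ]`.
  origin : All (_≢ []) cs → All (All (_≤ x)) cs → AllPairs _≺_ cs → x ∈ concat cs → Origin x cs
  origin {C ∷ cs} (n ∷ ne) (le ∷ les) (o ∷ os) x∈ with ∈-++⁻ C x∈
  ... | inj₂ x∈cs with origin ne les os x∈cs
  ...   | inserted e ne′ = inserted (there e) (n ∷ ne′)
  ...   | appended bs    = appended (C ∷ bs)
  origin {C ∷ cs} {x} (n ∷ ne) (le ∷ les) (o ∷ os) x∈ | inj₁ x∈C with ∈-∃++ x∈C
  ... | p ∷ ps , qs     , refl = inserted (here {B = p ∷ ps ++ qs} (∈-inserts⁺ (p ∷ ps))) ((λ ()) ∷ ne)
  ... | []     , q ∷ qs , refl = inserted (here {B = q ∷ qs} (∈-inserts⁺ [])) ((λ ()) ∷ ne)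
  -- The block is `[ x ]`, and it must be the last one: the canonical order would place all elements
  -- of a later non-empty block above the maximum `x`.
  ... | []     , []     , refl with ne | les | o
  ...   | []     | []     | []            = appended []
  ...   | n ∷ _  | le ∷ _ | here lt ∷ _   = contradiction lt (¬max< n le)

  Lah-origin : Lah r (suc m) ℓ cs → Origin (suc m) cs
  Lah-origin {m = m} d = origin nonEmpty bounded canonical
    (∈-resp-↭ (↭-sym (↭-trans ground (interval-∷ʳ m))) (here refl))
    where open Lah d

  Lah-extension⇒≤ : Extension (suc m) bs cs → All (_≢ []) bs → Lah r (suc m) ℓ cs → r ≤ m
  Lah-extension⇒≤ e ne d = ≤-pred (extension⇒< e ne (Lah.bounded< (Lah-extension⁻ e ne d)) (Lah.separated d))

  -- Distributions with `m ≤ r` and the least number of blocks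

  singletons : ℕ → List Block
  singletons zero    = []
  singletons (suc m) = singletons m ∷ʳ [ suc m ]

  Lah-singletons : ∀ r m → Lah r m m (singletons m)
  Lah-singletons r zero    = record
    { count = refl ; nonEmpty = [] ; ground = ↭-refl ; separated = [] ; canonical = [] }
  Lah-singletons r (suc m) = Lah-∷ʳ⁺ (Lah-singletons r m)

  -- As long as `m ≤ r`, no element may join a block of smaller elements, so each one in turn was
  -- appended as a singleton.
  Lah-base : ∀ m → m ≤ r → Lah r m ℓ bs → ℓ ≡ m × bs ≡ singletons m
  Lah-base {bs = []}     zero _ d = sym (Lah.count d) , refl
  Lah-base {bs = B ∷ bs} zero _ d with B | Lah.nonEmpty d | Lah.size d
  ... | []    | n ∷ _ | _  = contradiction refl n
  ... | _ ∷ _ | _     | ()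
  Lah-base (suc m) m<r d with Lah-origin d
  ... | inserted e ne = contradiction (Lah-extension⇒≤ e ne d) (<⇒≱ m<r)
  ... | appended bs
    with _ , refl , d′ ← Lah-∷ʳ⁻ d
    with refl , refl ← Lah-base m (<⇒≤ m<r) d′
    = refl , refl

  -- Removing the `n` largest elements one by one never increases the number of blocks, and leaves
  -- the `r` singletons of `Lah-base`.
  Lah-blocks : ∀ n → Lah r (n + r) ℓ bs → r ≤ ℓ
  Lah-blocks zero d with refl , _ ← Lah-base _ ≤-refl d = ≤-refl
  Lah-blocks (suc n) d with Lah-origin d
  ... | inserted e ne = Lah-blocks n (Lah-extension⁻ e ne d)
  ... | appended bs with _ , refl , d′ ← Lah-∷ʳ⁻ d = m≤n⇒m≤1+n (Lah-blocks n d′)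

  -- Deleting x undoes an extension by x, so different distributions have disjoint
  -- sets of extensions.
  delete : ℕ → List Block → List Block
  delete x = map (filter (λ i → ¬? (i ≟ x)))

  delete-inserts : ∀ B → All (_< x) B → C ∈ inserts x B → filter (λ i → ¬? (i ≟ x)) C ≡ B
  delete-inserts {x} B lt p with ps , qs , refl , refl ← ∈-inserts⁻ B p =
    trans (filter-++ ≢x? ps (x ∷ qs))
      (cong₂ _++_ (filter-all ≢x? (All.map <⇒≢ (All.++⁻ˡ ps lt)))
        (trans (filter-reject ≢x? (λ n → n refl)) (filter-all ≢x? (All.map <⇒≢ (All.++⁻ʳ ps lt)))))
    where ≢x? = λ i → ¬? (i ≟ x)

  delete-fresh : All (All (_< x)) bs → delete x bs ≡ bs
  delete-fresh []         = refl
  delete-fresh (lt ∷ lts) = cong₂ _∷_ (filter-all _ (All.map <⇒≢ lt)) (delete-fresh lts)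

  delete-extension : All (All (_< x)) bs → Extension x bs cs → delete x cs ≡ bs
  delete-extension (lt ∷ lts) (here {B = B} p) = cong₂ _∷_ (delete-inserts B lt p) (delete-fresh lts)
  delete-extension (lt ∷ lts) (there e) =
    cong₂ _∷_ (filter-all _ (All.map <⇒≢ lt)) (delete-extension lts e)

  extensions-unique : All (All (_< x)) bs → Unique (extensions x bs)
  extensions-unique []                     = []
  extensions-unique {x} {B ∷ bs} (lt ∷ lts) = Unique.++⁺
    (Unique.map⁺ ∷-injectiveˡ (inserts-unique B x∉))
    (Unique.map⁺ ∷-injectiveʳ (extensions-unique lts))
    λ (p , q) → disj p q
    where
    x∉ : x ∉ B
    x∉ x∈ = <-irrefl refl (All.lookup lt x∈)
    disj : ∀ {cs} → cs ∈ map (_∷ bs) (inserts x B) → ¬ cs ∈ map (B ∷_) (extensions x bs)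
    -- In the first list the head block contains `x`; in the second it is `B`, which does not.
    disj p q with _ , p′ , refl ← ∈-map⁻ _ p with _ , _ , refl ← ∈-map⁻ _ q =
      x∉ (∈-resp-↭ (↭-sym (inserts-↭ B p′)) (here refl))

  -- Deleting `x` turns the last block `[ x ]` into an empty block, whereas deleting it from an
  -- extension gives back `bs`, where all blocks are non-empty.
  appended-not-extension : All (_≢ []) bs → All (All (_< x)) bs → ¬ Extension x bs (cs ∷ʳ [ x ])
  appended-not-extension {x = x} {cs = cs} ne lts e =
    proj₂ (All.∷ʳ⁻ (subst (All (_≢ [])) eq ne)) (filter-reject ≢x? (λ n → n refl))
    where
    ≢x? = λ i → ¬? (i ≟ x)
    eq = trans (sym (delete-extension lts e)) (map-++ (filter ≢x?) cs [ [ x ] ])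

  -- Recurrences for the sets `𝓛`

  ∈𝓛⇒Lah : ∀ n k → bs ∈ 𝓛 r n k → Lah r (n + r) (k + r) bs
  ∈𝓛⇒Lah n k = Equivalence.to Lah⇔ ∘ Equivalence.to ∈-𝓛

  Lah⇒∈𝓛 : ∀ n k → Lah r (n + r) (k + r) bs → bs ∈ 𝓛 r n k
  Lah⇒∈𝓛 n k = Equivalence.from ∈-𝓛 ∘ Equivalence.from Lah⇔

  𝓛-extensions : (r n k : ℕ) → List (List Block)
  𝓛-extensions r n k = concatMap (extensions (suc (n + r))) (𝓛 r n k)

  ∈-𝓛-extensions⁺ : ∀ {n k} → Extension (suc (n + r)) bs cs → Lah r (n + r) (k + r) bs → cs ∈ 𝓛-extensions r n k
  ∈-𝓛-extensions⁺ {r = r} {n = n} {k} e d =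
    ∈-concatMap⁺ (extensions (suc (n + r))) (lose (Lah⇒∈𝓛 n k d) (∈-extensions⁺ e))

  ∈-𝓛-extensions⁻ : ∀ {n k} → cs ∈ 𝓛-extensions r n k →
                    ∃[ bs ] Lah r (n + r) (k + r) bs × Extension (suc (n + r)) bs cs
  ∈-𝓛-extensions⁻ {r = r} {n = n} {k} p
    with bs , q , e ← find (∈-concatMap⁻ (extensions (suc (n + r))) {xs = 𝓛 r n k} p)
    = bs , ∈𝓛⇒Lah n k q , ∈-extensions⁻ bs e

  𝓛-extensions-unique : ∀ r n k → Unique (𝓛-extensions r n k)
  𝓛-extensions-unique r n k = Unique.concat⁺
    (All.map⁺ (All.tabulate λ p → extensions-unique (Lah.bounded< (∈𝓛⇒Lah n k p))))
    (AllPairs.map⁺ (disjoint (All.tabulate (∈𝓛⇒Lah n k)) (𝓛-unique r n k)))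
    where
    disjoint : ∀ {bss} → All (Lah r (n + r) (k + r)) bss → Unique bss →
               AllPairs (λ bs cs → Disjoint (extensions (suc (n + r)) bs) (extensions (suc (n + r)) cs)) bss
    disjoint []       []       = []
    disjoint (d ∷ ds) (u ∷ us) = All.zipWith
      (λ (d′ , ≢bs) {_} (p , q) → ≢bs
        (trans (sym (delete-extension (Lah.bounded< d) (∈-extensions⁻ _ p)))
               (delete-extension (Lah.bounded< d′) (∈-extensions⁻ _ q))))
      (ds , u) ∷ disjoint ds us

  𝓛-suc-zero : ∀ r n → 𝓛 r (suc n) 0 ↭ 𝓛-extensions r n 0
  𝓛-suc-zero r n = unique∧set⇒↭ (𝓛-unique r (suc n) 0) (𝓛-extensions-unique r n 0) to from
    where
    to : ∀ {cs} → cs ∈ 𝓛 r (suc n) 0 → cs ∈ 𝓛-extensions r n 0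
    to p with d ← ∈𝓛⇒Lah (suc n) 0 p with Lah-origin {m = n + r} d
    ... | inserted e ne = ∈-𝓛-extensions⁺ e (Lah-extension⁻ e ne d)
    -- Here there are exactly `r` blocks; without the last one, fewer than `r` would remain, against
    -- `Lah-blocks`.
    ... | appended bs with _ , eq , d′ ← Lah-∷ʳ⁻ d =
      contradiction (subst (_≤ _) eq (Lah-blocks n d′)) (<⇒≱ ≤-refl)
    from : ∀ {cs} → cs ∈ 𝓛-extensions r n 0 → cs ∈ 𝓛 r (suc n) 0
    from p with _ , d , e ← ∈-𝓛-extensions⁻ {n = n} {k = 0} p = Lah⇒∈𝓛 (suc n) 0 (Lah-extension⁺ (m≤n+m r n) e d)

  -- The two summands are the two cases of `Origin`; `appended-not-extension` makes them disjoint.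
  𝓛-suc-suc : ∀ r n k → 𝓛 r (suc n) (suc k) ↭
              𝓛-extensions r n (suc k) ++ map (_∷ʳ [ suc (n + r) ]) (𝓛 r n k)
  𝓛-suc-suc r n k = unique∧set⇒↭ (𝓛-unique r (suc n) (suc k))
    (Unique.++⁺ (𝓛-extensions-unique r n (suc k))
      (Unique.map⁺ (∷ʳ-injectiveˡ _ _) (𝓛-unique r n k)) (λ (p , q) → disj p q))
    to from
    where
    disj : ∀ {cs} → cs ∈ 𝓛-extensions r n (suc k) → ¬ cs ∈ map (_∷ʳ [ suc (n + r) ]) (𝓛 r n k)
    disj p q with _ , d , e ← ∈-𝓛-extensions⁻ {n = n} {k = suc k} p with _ , _ , refl ← ∈-map⁻ _ q =
      appended-not-extension (Lah.nonEmpty d) (Lah.bounded< d) e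
    to : ∀ {cs} → cs ∈ 𝓛 r (suc n) (suc k) → cs ∈ 𝓛-extensions r n (suc k) ++ map (_∷ʳ [ suc (n + r) ]) (𝓛 r n k)
    to p with d ← ∈𝓛⇒Lah (suc n) (suc k) p with Lah-origin {m = n + r} d
    ... | inserted e ne = ∈-++⁺ˡ (∈-𝓛-extensions⁺ e (Lah-extension⁻ e ne d))
    ... | appended bs with _ , refl , d′ ← Lah-∷ʳ⁻ d = ∈-++⁺ʳ _ (∈-map⁺ _ (Lah⇒∈𝓛 n k d′))
    from : ∀ {cs} → cs ∈ 𝓛-extensions r n (suc k) ++ map (_∷ʳ [ suc (n + r) ]) (𝓛 r n k) → cs ∈ 𝓛 r (suc n) (suc k)
    from p with ∈-++⁻ (𝓛-extensions r n (suc k)) p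
    ... | inj₁ q with _ , d , e ← ∈-𝓛-extensions⁻ {n = n} {k = suc k} q = Lah⇒∈𝓛 (suc n) (suc k) (Lah-extension⁺ (m≤n+m r n) e d)
    ... | inj₂ q with _ , q′ , refl ← ∈-map⁻ _ q = Lah⇒∈𝓛 (suc n) (suc k) (Lah-∷ʳ⁺ (∈𝓛⇒Lah n k q′))

  𝓛-zero-zero : ∀ r → 𝓛 r 0 0 ↭ [ singletons r ]
  𝓛-zero-zero r = unique∧set⇒↭ (𝓛-unique r 0 0) ([] ∷ [])
    (λ p → here (proj₂ (Lah-base r ≤-refl (∈𝓛⇒Lah 0 0 p))))
    (λ { (here refl) → Lah⇒∈𝓛 0 0 (Lah-singletons r r) })

  𝓛-zero-suc : ∀ r k → 𝓛 r 0 (suc k) ↭ []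
  𝓛-zero-suc r k = unique∧set⇒↭ (𝓛-unique r 0 (suc k)) []
    (λ p → contradiction (sym (proj₁ (Lah-base r ≤-refl (∈𝓛⇒Lah 0 (suc k) p)))) (<⇒≢ (s≤s (m≤n+m r k))))
    λ ()

  -- Record lows under insertion

  module _ {A : Set} {P Q : A → Set} (P? : Decidable P) (Q? : Decidable Q) where

    length-filter-cong : ∀ {xs} → All (λ i → P i ⇔ Q i) xs →
                         length (filter P? xs) ≡ length (filter Q? xs)
    length-filter-cong []                 = refl
    length-filter-cong {x ∷ xs} (e ∷ es) with P? x | Q? x
    ... | yes _ | yes _ = cong suc (length-filter-cong es)
    ... | no _  | no _  = length-filter-cong es
    ... | yes p | no ¬q = contradiction (Equivalence.to e p) ¬q
    ... | no ¬p | yes q = contradiction (Equivalence.from e q) ¬p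

    -- Being a record low depends on the whole word, so `P` refers to the word with `x` and `Q` to
    -- the word without it. They agree on the old letters, and the count changes only by the
    -- contribution of `x`.
    length-filter-++ : ∀ ps {x qs} → All (λ i → P i ⇔ Q i) (ps ++ qs) →
                       length (filter P? (ps ++ x ∷ qs)) ≡
                       length (filter P? [ x ]) + length (filter Q? (ps ++ qs))
    length-filter-++ [] {x} {qs} es = trans (cong length (filter-++ P? [ x ] qs))
      (trans (length-++ (filter P? [ x ])) (cong (_ +_) (length-filter-cong es)))
    length-filter-++ (p ∷ ps) (e ∷ es) with P? p | Q? p
    ... | yes _ | yes _ = trans (cong suc (length-filter-++ ps es)) (sym (+-suc _ _))
    ... | no _  | no _  = length-filter-++ ps es
    ... | yes p | no ¬q = contradiction (Equivalence.to e p) ¬q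
    ... | no ¬p | yes q = contradiction (Equivalence.from e q) ¬p

  module _ {A : Set} {P Q : A → Set} (P? : Decidable P) where

    -- Because `P x` holds, the prefix does not stop at `x`: it either ends before `x` or gains just
    -- this letter.
    All-takeWhile-insert⁺ : ∀ ps {x qs} → P x → Q x → All Q (takeWhile P? (ps ++ qs)) →
                            All Q (takeWhile P? (ps ++ x ∷ qs))
    All-takeWhile-insert⁺ []       {x} p q h rewrite dec-true (P? x) p = q ∷ h
    All-takeWhile-insert⁺ (y ∷ ps) {x} p q h with does (P? y)
    All-takeWhile-insert⁺ (y ∷ ps) {x} p q (q′ ∷ h) | true = q′ ∷ All-takeWhile-insert⁺ ps p q h
    ... | false = []

    All-takeWhile-insert⁻ : ∀ ps {x qs} → P x → All Q (takeWhile P? (ps ++ x ∷ qs)) →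
                            All Q (takeWhile P? (ps ++ qs))
    All-takeWhile-insert⁻ []       {x} p h rewrite dec-true (P? x) p = All.tail h
    All-takeWhile-insert⁻ (y ∷ ps) {x} p h with does (P? y)
    All-takeWhile-insert⁻ (y ∷ ps) {x} p (q′ ∷ h) | true = q′ ∷ All-takeWhile-insert⁻ ps p h
    ... | false = []

  All-insert⁺ : ∀ {A : Set} {P : A → Set} ps {x qs} → P x → All P (ps ++ qs) → All P (ps ++ x ∷ qs)
  All-insert⁺ ps p h = All.++⁺ (All.++⁻ˡ ps h) (p ∷ All.++⁻ʳ ps h)

  All-insert⁻ : ∀ {A : Set} {P : A → Set} ps {x qs} → All P (ps ++ x ∷ qs) → All P (ps ++ qs)
  All-insert⁻ ps h = All.++⁺ (All.++⁻ˡ ps h) (All.tail (All.++⁻ʳ ps h))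

  -- The letter `x` is not `i`, so it does not cut off `leftOf i`, and it is not below `i`, so it
  -- does not spoil a record low.
  RecordLow-insert : ∀ ps {qs} → i < x → RecordLow (ps ++ x ∷ qs) i ⇔ RecordLow (ps ++ qs) i
  RecordLow-insert {i} ps i<x = mk⇔
    (All-takeWhile-insert⁻ (λ j → ¬? (j ≟ i)) ps (<⇒≢ i<x ∘ sym))
    (All-takeWhile-insert⁺ (λ j → ¬? (j ≟ i)) ps (<⇒≢ i<x ∘ sym) (<⇒≯ i<x))

  Smallest-insert : ∀ ps {qs} → i < x → Smallest (ps ++ x ∷ qs) i ⇔ Smallest (ps ++ qs) i
  Smallest-insert ps i<x = mk⇔ (All-insert⁻ ps) (All-insert⁺ ps (<⇒≤ i<x))

  leftOf-head : ∀ x B → leftOf x (x ∷ B) ≡ []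
  leftOf-head x B rewrite dec-true (x ≟ x) refl = refl

  RecordLow-head : ∀ x B → RecordLow (x ∷ B) x
  RecordLow-head x B = subst (All _) (sym (leftOf-head x B)) []

  -- The first letter `y` differs from `x`, so it belongs to `leftOf x`, and it is smaller than `x`.
  ¬RecordLow-after : ∀ {y} → y < x → ¬ RecordLow (y ∷ B) x
  ¬RecordLow-after {x} {y = y} y<x h rewrite dec-false (y ≟ x) (<⇒≢ y<x) = All.head h y<x

  -- The summands of `nrec` and `rec*`, so that both statistics unfold block by block by
  -- computation.
  nrecBlock rec*Block : Block → ℕ
  nrecBlock B = length (filter (λ i → ¬? (recordLow? B i)) B)
  rec*Block B = length (filter (λ i → recordLow? B i ×-dec ¬? (smallest? B i)) B)

  ¬-cong : ∀ {P Q : Set} → P ⇔ Q → (¬ P) ⇔ (¬ Q)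
  ¬-cong e = mk⇔ (_∘ Equivalence.from e) (_∘ Equivalence.to e)

  module _ (ps : List ℕ) {x qs} (lt : All (_< x) (ps ++ qs)) where

    nrec-insert : nrecBlock (ps ++ x ∷ qs) ≡
                  length (filter (λ i → ¬? (recordLow? (ps ++ x ∷ qs) i)) [ x ]) + nrecBlock (ps ++ qs)
    nrec-insert = length-filter-++ _ _ ps (All.map (¬-cong ∘ RecordLow-insert ps) lt)

    rec*-insert : rec*Block (ps ++ x ∷ qs) ≡
                  length (filter (λ i → recordLow? (ps ++ x ∷ qs) i ×-dec ¬? (smallest? (ps ++ x ∷ qs) i)) [ x ])
                  + rec*Block (ps ++ qs)
    rec*-insert = length-filter-++ _ _ ps (All.map (λ i<x →
      let r = RecordLow-insert ps i<x ; s = ¬-cong (Smallest-insert ps i<x) in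
      mk⇔ (λ (p , q) → Equivalence.to r p , Equivalence.to s q)
          (λ (p , q) → Equivalence.from r p , Equivalence.from s q)) lt)

  nrec-front : All (_< x) B → nrecBlock (x ∷ B) ≡ nrecBlock B
  nrec-front {x} {B} lt = trans (nrec-insert [] lt)
    (cong (λ xs → length xs + _) (filter-reject (λ i → ¬? (recordLow? (x ∷ B) i)) (λ n → n (RecordLow-head x B))))

  -- At the front `x` has nothing to its left, so it is a record low; the non-empty rest has a
  -- smaller letter, so `x` is not the minimum and is counted.
  rec*-front : All (_< x) B → B ≢ [] → rec*Block (x ∷ B) ≡ suc (rec*Block B)
  rec*-front {B = []} _ n = contradiction refl n
  rec*-front {x} {B = y ∷ B} lt@(y<x ∷ _) _ = trans (rec*-insert [] lt)
    (cong (λ xs → length xs + _)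
      (filter-accept (λ i → recordLow? (x ∷ y ∷ B) i ×-dec ¬? (smallest? (x ∷ y ∷ B) i))
        (RecordLow-head x (y ∷ B) , λ { (_ ∷ x≤y ∷ _) → <⇒≱ y<x x≤y })))

  module _ {x y} ps {qs} (lt : All (_< x) (y ∷ ps ++ qs)) where

    nrec-after : nrecBlock (y ∷ ps ++ x ∷ qs) ≡ suc (nrecBlock (y ∷ ps ++ qs))
    nrec-after = trans (nrec-insert (y ∷ ps) lt)
      (cong (λ xs → length xs + _)
        (filter-accept (λ i → ¬? (recordLow? (y ∷ ps ++ x ∷ qs) i)) (¬RecordLow-after (All.head lt))))

    rec*-after : rec*Block (y ∷ ps ++ x ∷ qs) ≡ rec*Block (y ∷ ps ++ qs)
    rec*-after = trans (rec*-insert (y ∷ ps) lt)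
      (cong (λ xs → length xs + _)
        (filter-reject (λ i → recordLow? (y ∷ ps ++ x ∷ qs) i ×-dec ¬? (smallest? (y ∷ ps ++ x ∷ qs) i))
          (¬RecordLow-after (All.head lt) ∘ proj₁)))

  nrec-singleton : ∀ x → nrecBlock [ x ] ≡ 0
  nrec-singleton x = nrec-front {x} []

  -- The only letter is the minimum of its block, which `rec*` leaves out.
  rec*-singleton : ∀ x → rec*Block [ x ] ≡ 0
  rec*-singleton x = cong length
    (filter-reject (λ i → recordLow? [ x ] i ×-dec ¬? (smallest? [ x ] i)) (λ (_ , n) → n (≤-refl ∷ [])))

  nrec-∷ʳ : ∀ bs x → nrec (bs ∷ʳ [ x ]) ≡ nrec bs
  nrec-∷ʳ []       x = cong (_+ 0) (nrec-singleton x)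
  nrec-∷ʳ (B ∷ bs) x = cong (nrecBlock B +_) (nrec-∷ʳ bs x)

  rec*-∷ʳ : ∀ bs x → rec* (bs ∷ʳ [ x ]) ≡ rec* bs
  rec*-∷ʳ []       x = cong (_+ 0) (rec*-singleton x)
  rec*-∷ʳ (B ∷ bs) x = cong (rec*Block B +_) (rec*-∷ʳ bs x)

  nrec-singletons : ∀ m → nrec (singletons m) ≡ 0
  nrec-singletons zero    = refl
  nrec-singletons (suc m) = trans (nrec-∷ʳ (singletons m) _) (nrec-singletons m)

  rec*-singletons : ∀ m → rec* (singletons m) ≡ 0
  rec*-singletons zero    = refl
  rec*-singletons (suc m) = trans (rec*-∷ʳ (singletons m) _) (rec*-singletons m)

open LahDistributions

-- The recurrence for the generalized r-Lah polynomials

module Sums {c ℓ} (R : CommutativeRing c ℓ) where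
  open CommutativeRing R hiding (zero)
  open GeneralizedLah R
  open import Algebra.Properties.Semiring.Mult semiring using (×-assoc-*; ×-homo-+) renaming (_×_ to _·_)
  open import Algebra.Properties.Semiring.Exp semiring using (^-homo-*)
  open import Algebra.Properties.CommutativeSemigroup *-commutativeSemigroup
    using (x∙yz≈y∙xz) renaming (interchange to *-interchange)
  open import Algebra.Properties.CommutativeSemigroup +-commutativeSemigroup
    using () renaming (interchange to +-interchange)
  open import Relation.Binary.Reasoning.Setoid setoid

  private variable
    A A′ : Set
    x : ℕ
    B : Block
    f g : A → Carrier

  -- Finite sums over lists

  ∑-↭ : ∀ {xs ys : List A} → xs ↭ ys → ∑ xs f ≈ ∑ ys f
  ∑-↭ _↭_.refl        = refl
  ∑-↭ (prep x p)      = +-congˡ (∑-↭ p)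
  ∑-↭ (swap x y p)    =
    trans (sym (+-assoc _ _ _)) (trans (+-cong (+-comm _ _) (∑-↭ p)) (+-assoc _ _ _))
  ∑-↭ (_↭_.trans p q) = trans (∑-↭ p) (∑-↭ q)

  ∑-++ : ∀ (xs : List A) {ys} → ∑ (xs ++ ys) f ≈ ∑ xs f + ∑ ys f
  ∑-++ []       = sym (+-identityˡ _)
  ∑-++ (x ∷ xs) = trans (+-congˡ (∑-++ xs)) (sym (+-assoc _ _ _))

  ∑-map : ∀ (h : A → A′) {f : A′ → Carrier} xs → ∑ (map h xs) f ≡ ∑ xs (f ∘ h)
  ∑-map h {f} xs = cong (foldr _+_ 0#) (≡.sym (map-∘ xs))

  ∑-cong : ∀ {xs : List A} → All (λ x → f x ≈ g x) xs → ∑ xs f ≈ ∑ xs g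
  ∑-cong []       = refl
  ∑-cong (e ∷ es) = +-cong e (∑-cong es)

  ∑-concatMap : ∀ (h : A → List A′) {f : A′ → Carrier} xs → ∑ (concatMap h xs) f ≈ ∑ xs (λ x → ∑ (h x) f)
  ∑-concatMap h []       = refl
  ∑-concatMap h (x ∷ xs) = trans (∑-++ (h x)) (+-congˡ (∑-concatMap h xs))

  ∑-*ˡ : ∀ c {f : A → Carrier} xs → ∑ xs (λ x → c * f x) ≈ c * ∑ xs f
  ∑-*ˡ c []       = sym (zeroʳ c)
  ∑-*ˡ c (x ∷ xs) = trans (+-congˡ (∑-*ˡ c xs)) (sym (distribˡ c _ _))

  ∑-*ʳ : ∀ c {f : A → Carrier} xs → ∑ xs (λ x → f x * c) ≈ ∑ xs f * c
  ∑-*ʳ c []       = sym (zeroˡ c)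
  ∑-*ʳ c (x ∷ xs) = trans (+-congˡ (∑-*ʳ c xs)) (sym (distribʳ c _ _))

  ∑-const : ∀ c (xs : List A) → ∑ xs (λ _ → c) ≡ length xs · c
  ∑-const c []       = ≡.refl
  ∑-const c (x ∷ xs) = cong (c +_) (∑-const c xs)

  ∑-+ : ∀ {f g : A → Carrier} xs → ∑ xs (λ x → f x + g x) ≈ ∑ xs f + ∑ xs g
  ∑-+ []       = sym (+-identityˡ _)
  ∑-+ {f = f} {g} (x ∷ xs) = trans (+-congˡ (∑-+ xs)) (+-interchange _ _ _ _)

  -- Here `m` is the number of elements already present, each offering the place right after it, and
  -- `ℓ` the number of blocks, each offering its front.
  coefficient : (u v : Carrier) → ℕ → ℕ → Carrier
  coefficient u v m ℓ = m · u + ℓ · v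

  -- Weights of distributions and the recurrence

  module _ (u v : Carrier) where

    blockWeight : Block → Carrier
    blockWeight B = u ^ nrecBlock B * v ^ rec*Block B

    weight : List Block → Carrier
    weight bs = u ^ nrec bs * v ^ rec* bs

    weight-∷ : ∀ B bs → weight (B ∷ bs) ≈ blockWeight B * weight bs
    weight-∷ B bs = trans
      (*-cong (^-homo-* u (nrecBlock B) (nrec bs)) (^-homo-* v (rec*Block B) (rec* bs)))
      (*-interchange _ _ _ _)

    weight-∷ʳ : ∀ bs x → weight (bs ∷ʳ [ x ]) ≡ weight bs
    weight-∷ʳ bs x = cong₂ (λ i j → u ^ i * v ^ j) (nrec-∷ʳ bs x) (rec*-∷ʳ bs x)

    weight-front : All (_< x) B → B ≢ [] → blockWeight (x ∷ B) ≈ v * blockWeight B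
    weight-front {x} {B} lt ne = begin
      blockWeight (x ∷ B)                          ≡⟨ cong₂ (λ i j → u ^ i * v ^ j) (nrec-front lt) (rec*-front lt ne) ⟩
      u ^ nrecBlock B * (v * v ^ rec*Block B)      ≈⟨ x∙yz≈y∙xz _ _ _ ⟩
      v * blockWeight B                            ∎

    weight-after : ∀ {y ps qs} → All (_< x) (y ∷ ps ++ qs) →
                   blockWeight (y ∷ ps ++ x ∷ qs) ≈ u * blockWeight (y ∷ ps ++ qs)
    weight-after {x} {y} {ps} {qs} lt = begin
      blockWeight (y ∷ ps ++ x ∷ qs)               ≡⟨ cong₂ (λ i j → u ^ i * v ^ j) (nrec-after ps lt) (rec*-after ps lt) ⟩
      u * u ^ nrecBlock (y ∷ ps ++ qs) * _         ≈⟨ *-assoc _ _ _ ⟩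
      u * blockWeight (y ∷ ps ++ qs)               ∎

    -- The front position contributes a factor `v`, and the position after each of the `length B`
    -- letters a factor `u`.
    ∑-inserts : All (_< x) B → B ≢ [] →
                ∑ (inserts x B) blockWeight ≈ (length B · u + v) * blockWeight B
    ∑-inserts {B = []} _ n = contradiction ≡.refl n
    ∑-inserts {x} {B = B@(y ∷ B′)} lt ne = begin
      blockWeight (x ∷ B) + ∑ (map (y ∷_) (inserts x B′)) blockWeight
        ≈⟨ +-cong (weight-front lt ne) (∑-cong {g = λ _ → u * W} (All.map⁺ (All.tabulate after))) ⟩
      v * W + ∑ (map (y ∷_) (inserts x B′)) (λ _ → u * W)
        ≡⟨ cong (v * W +_) (∑-const (u * W) (map (y ∷_) (inserts x B′))) ⟩
      v * W + length (map (y ∷_) (inserts x B′)) · (u * W)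
        -- The positions behind `y` are the `suc (length B′)` positions in `B′`, and this number is
        -- `length B`.
        ≡⟨ cong (λ l → v * W + l · (u * W))
             (≡.trans (length-map (y ∷_) (inserts x B′)) (length-inserts x B′)) ⟩
      v * W + length B · (u * W)
        ≈⟨ +-congˡ (×-assoc-* (length B) u W) ⟨
      v * W + (length B · u) * W
        ≈⟨ distribʳ W v (length B · u) ⟨
      (v + length B · u) * W
        ≈⟨ *-congʳ (+-comm v _) ⟩
      (length B · u + v) * W ∎
      where
      W = blockWeight B
      after : ∀ {C} → C ∈ inserts x B′ → blockWeight (y ∷ C) ≈ u * W
      after p with ps , qs , ≡.refl , ≡.refl ← ∈-inserts⁻ B′ p = weight-after {ps = ps} lt

    -- Weights multiply over blocks, so an insertion into one block leaves the other factors alone;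
    -- adding the contributions of the blocks adds up their lengths and counts them.
    ∑-extensions : ∀ bs → All (_≢ []) bs → All (All (_< x)) bs →
      ∑ (extensions x bs) weight ≈ coefficient u v (length (concat bs)) (length bs) * weight bs
    ∑-extensions []       _ _ = sym (trans (*-congʳ (+-identityˡ 0#)) (zeroˡ _))
    ∑-extensions {x} (B ∷ bs) (n ∷ ne) (lt ∷ lts) = begin
      ∑ (map (_∷ bs) (inserts x B) ++ map (B ∷_) (extensions x bs)) weight
        ≈⟨ ∑-++ (map (_∷ bs) (inserts x B)) ⟩
      ∑ (map (_∷ bs) (inserts x B)) weight + ∑ (map (B ∷_) (extensions x bs)) weight
        ≡⟨ cong₂ _+_ (∑-map (_∷ bs) (inserts x B)) (∑-map (B ∷_) (extensions x bs)) ⟩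
      ∑ (inserts x B) (λ C → weight (C ∷ bs)) + ∑ (extensions x bs) (λ cs → weight (B ∷ cs))
        ≈⟨ +-cong (∑-cong (All.universal (λ C → weight-∷ C bs) (inserts x B)))
                  (∑-cong (All.universal (weight-∷ B) (extensions x bs))) ⟩
      ∑ (inserts x B) (λ C → blockWeight C * w) + ∑ (extensions x bs) (λ cs → W * weight cs)
        ≈⟨ +-cong (∑-*ʳ w (inserts x B)) (∑-*ˡ W (extensions x bs)) ⟩
      ∑ (inserts x B) blockWeight * w + W * ∑ (extensions x bs) weight
        ≈⟨ +-cong (*-congʳ (∑-inserts lt n)) (*-congˡ (∑-extensions bs ne lts)) ⟩
      (length B · u + v) * W * w + W * ((M + L) * w)
        ≈⟨ +-cong (*-assoc _ _ _) (x∙yz≈y∙xz _ _ _) ⟩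
      (length B · u + v) * (W * w) + (M + L) * (W * w)
        ≈⟨ distribʳ (W * w) _ _ ⟨
      (length B · u + v + (M + L)) * (W * w)
        ≈⟨ *-cong (+-interchange _ _ _ _) (sym (weight-∷ B bs)) ⟩
      (length B · u + M + (v + L)) * weight (B ∷ bs)
        ≈⟨ *-congʳ (+-congʳ (×-homo-+ u (length B) _)) ⟨
      ((length B +ℕ length (concat bs)) · u + (v + L)) * weight (B ∷ bs)
        ≡⟨ cong (λ l → (l · u + (v + L)) * weight (B ∷ bs)) (≡.sym (length-++ B)) ⟩
      coefficient u v (length (concat (B ∷ bs))) (suc (length bs)) * weight (B ∷ bs) ∎
      where
      W = blockWeight B
      w = weight bs
      M = length (concat bs) · u
      L = length bs · v

    ∑-𝓛-extensions : ∀ n k r → ∑ (𝓛-extensions r n k) weight ≈ coefficient u v (n +ℕ r) (k +ℕ r) * 𝒢 u v n k r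
    ∑-𝓛-extensions n k r = begin
      ∑ (𝓛-extensions r n k) weight
        ≈⟨ ∑-concatMap (extensions (suc (n +ℕ r))) (𝓛 r n k) ⟩
      ∑ (𝓛 r n k) (λ bs → ∑ (extensions (suc (n +ℕ r)) bs) weight)
        ≈⟨ ∑-cong (All.tabulate step) ⟩
      ∑ (𝓛 r n k) (λ bs → coefficient u v (n +ℕ r) (k +ℕ r) * weight bs)
        ≈⟨ ∑-*ˡ (coefficient u v (n +ℕ r) (k +ℕ r)) (𝓛 r n k) ⟩
      coefficient u v (n +ℕ r) (k +ℕ r) * 𝒢 u v n k r ∎
      where
      step : ∀ {bs} → bs ∈ 𝓛 r n k →
             ∑ (extensions (suc (n +ℕ r)) bs) weight ≈ coefficient u v (n +ℕ r) (k +ℕ r) * weight bs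
      -- All members of `𝓛 r n k` have the same number of elements and of blocks, so the factor does
      -- not depend on `bs`.
      step {bs} p = trans (∑-extensions bs nonEmpty bounded<)
        (reflexive (cong₂ (λ m ℓ → coefficient u v m ℓ * weight bs) size count))
        where open Lah (∈𝓛⇒Lah n k p)

    𝒢-suc-zero : ∀ n r → 𝒢 u v (suc n) 0 r ≈ coefficient u v (n +ℕ r) r * 𝒢 u v n 0 r
    𝒢-suc-zero n r = trans (∑-↭ (𝓛-suc-zero r n)) (∑-𝓛-extensions n 0 r)

    𝒢-suc-suc : ∀ n k r → 𝒢 u v (suc n) (suc k) r ≈
                𝒢 u v n k r + coefficient u v (n +ℕ r) (suc k +ℕ r) * 𝒢 u v n (suc k) r
    𝒢-suc-suc n k r = begin
      𝒢 u v (suc n) (suc k) r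
        ≈⟨ ∑-↭ (𝓛-suc-suc r n k) ⟩
      ∑ (𝓛-extensions r n (suc k) ++ map (_∷ʳ [ suc (n +ℕ r) ]) (𝓛 r n k)) weight
        ≈⟨ ∑-++ (𝓛-extensions r n (suc k)) ⟩
      ∑ (𝓛-extensions r n (suc k)) weight + ∑ (map (_∷ʳ [ suc (n +ℕ r) ]) (𝓛 r n k)) weight
        ≈⟨ +-cong (∑-𝓛-extensions n (suc k) r) (reflexive (∑-map (_∷ʳ [ suc (n +ℕ r) ]) (𝓛 r n k))) ⟩
      _ + ∑ (𝓛 r n k) (λ bs → weight (bs ∷ʳ [ suc (n +ℕ r) ]))
        ≈⟨ +-congˡ (∑-cong (All.universal (λ bs → reflexive (weight-∷ʳ bs _)) (𝓛 r n k))) ⟩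
      _ + 𝒢 u v n k r
        ≈⟨ +-comm _ _ ⟩
      𝒢 u v n k r + coefficient u v (n +ℕ r) (suc k +ℕ r) * 𝒢 u v n (suc k) r ∎

    𝒢-zero-zero : ∀ r → 𝒢 u v 0 0 r ≈ 1#
    𝒢-zero-zero r = begin
      𝒢 u v 0 0 r                ≈⟨ ∑-↭ (𝓛-zero-zero r) ⟩
      weight (singletons r) + 0# ≈⟨ +-identityʳ _ ⟩
      weight (singletons r)      ≡⟨ cong₂ (λ i j → u ^ i * v ^ j) (nrec-singletons r) (rec*-singletons r) ⟩
      1# * 1#                    ≈⟨ *-identityˡ 1# ⟩
      1#                         ∎

    𝒢-zero-suc : ∀ k r → 𝒢 u v 0 (suc k) r ≈ 0#
    𝒢-zero-suc k r = ∑-↭ (𝓛-zero-suc r k)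

-- Orthogonality and composition

module Inversion {c ℓ} (R : CommutativeRing c ℓ) (r : ℕ) where
  open CommutativeRing R hiding (zero)
  open GeneralizedLah R
  open Sums R
  open import Algebra.Properties.Semiring.Mult semiring using (×-congʳ) renaming (_×_ to _·_)
  open import Algebra.Properties.CommutativeMonoid.Mult +-commutativeMonoid using (×-distrib-+)
  open import Algebra.Properties.Ring ring using (-1*x≈-x; -0#≈0#; -‿+-comm)
  open import Algebra.Properties.CommutativeSemigroup *-commutativeSemigroup
    using (x∙yz≈y∙xz) renaming (interchange to *-interchange)
  open import Algebra.Properties.CommutativeSemigroup +-commutativeSemigroup
    using () renaming (x∙yz≈y∙xz to x+[y+z]≈y+[x+z]; interchange to +-interchange)
  open import Relation.Binary.Reasoning.Setoid setoid

  G : (u v : Carrier) → ℕ → ℕ → Carrier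
  G u v n k = 𝒢 u v n k r

  C : (u v : Carrier) → ℕ → ℕ → Carrier
  C u v n k = coefficient u v (n +ℕ r) (k +ℕ r)

  -- Used to extend sums over `[ k ⋯ n ]` down to 0, to drop the boundary term in `∑-transpose`, and
  -- to settle the case of truncated subtraction in `G-negate`.
  G-vanishes : ∀ {u v} n k → n < k → G u v n k ≈ 0#
  G-vanishes {u} {v} zero    (suc k) _         = 𝒢-zero-suc u v k r
  G-vanishes {u} {v} (suc n) (suc k) (s<s n<k) = begin
    G u v (suc n) (suc k)                          ≈⟨ 𝒢-suc-suc u v n k r ⟩
    G u v n k + C u v n (suc k) * G u v n (suc k)  ≈⟨ +-cong (G-vanishes n k n<k) (*-congˡ (G-vanishes n (suc k) (m<n⇒m<1+n n<k))) ⟩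
    0# + C u v n (suc k) * 0#                      ≈⟨ +-identityˡ _ ⟩
    C u v n (suc k) * 0#                           ≈⟨ zeroʳ _ ⟩
    0#                                             ∎

  n·0≈0 : ∀ n → n · 0# ≈ 0#
  n·0≈0 zero    = refl
  n·0≈0 (suc n) = trans (+-identityˡ _) (n·0≈0 n)

  n·-‿inverse : ∀ n x → n · (- x) + n · x ≈ 0#
  n·-‿inverse n x = begin
    n · (- x) + n · x  ≈⟨ ×-distrib-+ (- x) x n ⟨
    n · (- x + x)      ≈⟨ ×-congʳ n (-‿inverseˡ x) ⟩
    n · 0#             ≈⟨ n·0≈0 n ⟩
    0#                 ∎

  n·-‿distrib : ∀ n x → n · (- x) ≈ - (n · x)
  n·-‿distrib zero    x = sym -0#≈0#
  n·-‿distrib (suc n) x = trans (+-congˡ (n·-‿distrib n x)) (-‿+-comm x (n · x))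

  -- Sums over ranges of indices

  ∑-applyUpTo : ∀ {f : ℕ → Carrier} (h : ℕ → ℕ) n → ∑ (applyUpTo h n) f ≡ ∑ (upTo n) (f ∘ h)
  ∑-applyUpTo {f} h n = cong (foldr _+_ 0#)
    (≡.trans (map-applyUpTo h f n) (≡.sym (map-upTo (f ∘ h) n)))

  ∑-upTo-suc : ∀ {f : ℕ → Carrier} n → ∑ (upTo (suc n)) f ≈ ∑ (upTo n) f + f n
  ∑-upTo-suc {f} n = begin
    ∑ (upTo (suc n)) f         ≡⟨ cong (λ xs → ∑ xs f) (≡.sym (upTo-∷ʳ n)) ⟩
    ∑ (upTo n ∷ʳ n) f          ≈⟨ ∑-++ (upTo n) ⟩
    ∑ (upTo n) f + (f n + 0#)  ≈⟨ +-congˡ (+-identityʳ (f n)) ⟩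
    ∑ (upTo n) f + f n         ∎

  -- The index function `h` is kept general because each removed term composes it with `suc`.
  ∑-drop : ∀ {f : ℕ → Carrier} (h : ℕ → ℕ) k m → (∀ i → i < k → f (h i) ≈ 0#) →
           ∑ (applyUpTo h (k +ℕ m)) f ≈ ∑ (applyUpTo (h ∘ (k +ℕ_)) m) f
  ∑-drop h zero    m f≈0 = refl
  ∑-drop h (suc k) m f≈0 = trans (+-cong (f≈0 0 z<s) (∑-drop (h ∘ suc) k m (λ i i<k → f≈0 (suc i) (s<s i<k))))
    (+-identityˡ _)

  -- The induction behind `composition` runs over full ranges starting at 0, which do not change
  -- with `k`; this passes between the two forms.
  ∑-interval : ∀ {f : ℕ → Carrier} k n → k ≤ n → (∀ i → i < k → f i ≈ 0#) →
               ∑ [ k ⋯ n ] f ≈ ∑ (upTo (suc n)) f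
  ∑-interval {f} k n k≤n f≈0 = begin
    ∑ [ k ⋯ n ] f                  ≈⟨ ∑-drop id k (suc n ∸ k) f≈0 ⟨
    ∑ (upTo (k +ℕ (suc n ∸ k))) f  ≡⟨ cong (λ m → ∑ (upTo m) f) (m+[n∸m]≡n (m≤n⇒m≤1+n k≤n)) ⟩
    ∑ (upTo (suc n)) f             ∎

  -- Summation by parts: the recurrence in n is moved from G onto φ.
  ∑-transpose : ∀ u v (φ : ℕ → Carrier) n →
    ∑ (upTo (suc (suc n))) (λ j → G u v (suc n) j * φ j) ≈
    ∑ (upTo (suc n)) (λ j → G u v n j * (φ (suc j) + C u v n j * φ j))
  ∑-transpose u v φ n = begin
    G u v (suc n) 0 * φ 0 + ∑ (applyUpTo suc (suc n)) (λ j → G u v (suc n) j * φ j)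
      ≈⟨ +-cong (*-congʳ (𝒢-suc-zero u v n r)) (reflexive (∑-applyUpTo suc (suc n))) ⟩
    q 0 + ∑ (upTo (suc n)) (λ j → G u v (suc n) (suc j) * φ (suc j))
      ≈⟨ +-congˡ (∑-cong (All.universal (λ j → trans (*-congʳ (𝒢-suc-suc u v n j r)) (distribʳ _ _ _)) (upTo (suc n)))) ⟩
    q 0 + ∑ (upTo (suc n)) (λ j → p j + q (suc j))
      ≈⟨ +-congˡ (∑-+ (upTo (suc n))) ⟩
    q 0 + (∑ (upTo (suc n)) p + ∑ (upTo (suc n)) (q ∘ suc))
      ≈⟨ x+[y+z]≈y+[x+z] _ _ _ ⟩
    ∑ (upTo (suc n)) p + (q 0 + ∑ (upTo (suc n)) (q ∘ suc))
      -- The separate term `q 0` completes the shifted terms to a sum of `q` from 0.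
      ≡⟨ cong (λ s → ∑ (upTo (suc n)) p + (q 0 + s)) (≡.sym (∑-applyUpTo suc (suc n))) ⟩
    ∑ (upTo (suc n)) p + ∑ (upTo (suc (suc n))) q
      ≈⟨ +-congˡ (∑-upTo-suc (suc n)) ⟩
    ∑ (upTo (suc n)) p + (∑ (upTo (suc n)) q + q (suc n))
      -- The top term contains `G u v n (suc n)`, which is above the diagonal; without it both sums
      -- have the same range.
      ≈⟨ +-congˡ (trans (+-congˡ q≈0) (+-identityʳ _)) ⟩
    ∑ (upTo (suc n)) p + ∑ (upTo (suc n)) q
      ≈⟨ ∑-+ (upTo (suc n)) ⟨
    ∑ (upTo (suc n)) (λ j → p j + q j)
      ≈⟨ ∑-cong (All.universal (λ j → p+q j) (upTo (suc n))) ⟩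
    ∑ (upTo (suc n)) (λ j → G u v n j * (φ (suc j) + C u v n j * φ j)) ∎
    where
    p q : ℕ → Carrier
    p j = G u v n j * φ (suc j)
    q j = C u v n j * G u v n j * φ j
    q≈0 : q (suc n) ≈ 0#
    q≈0 = trans (*-congʳ (trans (*-congˡ (G-vanishes n (suc n) ≤-refl)) (zeroʳ _))) (zeroˡ _)
    p+q : ∀ j → p j + q j ≈ G u v n j * (φ (suc j) + C u v n j * φ j)
    p+q j = trans (+-congˡ (trans (*-congʳ (*-comm _ _)) (*-assoc _ _ _))) (sym (distribˡ _ _ _))

  -- The right side is free of `j`, so in `composition` it can be taken out of the sum.
  C-+ : ∀ a b t n j k → C (- t) b j k + C a t n j ≈ C a b n k
  C-+ a b t n j k = begin
    J · (- t) + K · b + (N · a + J · t)    ≈⟨ +-congˡ (+-comm _ _) ⟩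
    J · (- t) + K · b + (J · t + N · a)    ≈⟨ +-interchange _ _ _ _ ⟩
    J · (- t) + J · t + (K · b + N · a)    ≈⟨ +-cong (n·-‿inverse J t) (+-comm _ _) ⟩
    0# + (N · a + K · b)                   ≈⟨ +-identityˡ _ ⟩
    N · a + K · b                          ∎
    where
    J = j +ℕ r
    K = k +ℕ r
    N = n +ℕ r

  -- Induction on `n` for all `k` at once, since the recurrence for row `suc n` uses both `k` and
  -- its predecessor. `∑-transpose` shifts the second factor to `suc j`, where its own recurrence
  -- applies, and `C-+` merges the two coefficients.
  composition : ∀ a b t n k → ∑ (upTo (suc n)) (λ j → G a t n j * G (- t) b j k) ≈ G a b n k
  composition a b t zero k = begin
    G a t 0 0 * G (- t) b 0 k + 0#  ≈⟨ +-identityʳ _ ⟩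
    G a t 0 0 * G (- t) b 0 k       ≈⟨ *-congʳ (𝒢-zero-zero a t r) ⟩
    1# * G (- t) b 0 k              ≈⟨ *-identityˡ _ ⟩
    G (- t) b 0 k                   ≈⟨ initial k ⟩
    G a b 0 k                       ∎
    where
    initial : ∀ k → G (- t) b 0 k ≈ G a b 0 k
    initial zero    = trans (𝒢-zero-zero (- t) b r) (sym (𝒢-zero-zero a b r))
    initial (suc k) = trans (𝒢-zero-suc (- t) b k r) (sym (𝒢-zero-suc a b k r))
  composition a b t (suc n) k = begin
    ∑ (upTo (suc (suc n))) (λ j → G a t (suc n) j * G′ j k)                 ≈⟨ ∑-transpose a t (λ j → G′ j k) n ⟩
    ∑ (upTo (suc n)) (λ j → G a t n j * (G′ (suc j) k + C a t n j * G′ j k)) ≈⟨ recurrence k ⟩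
    G a b (suc n) k                                                        ∎
    where
    G′ : ℕ → ℕ → Carrier
    G′ = G (- t) b

    collect : ∀ j k → G a t n j * (C (- t) b j k * G′ j k + C a t n j * G′ j k) ≈
                      C a b n k * (G a t n j * G′ j k)
    collect j k = begin
      G a t n j * (C (- t) b j k * G′ j k + C a t n j * G′ j k)  ≈⟨ *-congˡ (distribʳ _ _ _) ⟨
      G a t n j * ((C (- t) b j k + C a t n j) * G′ j k)         ≈⟨ *-congˡ (*-congʳ (C-+ a b t n j k)) ⟩
      G a t n j * (C a b n k * G′ j k)                           ≈⟨ x∙yz≈y∙xz _ _ _ ⟩
      C a b n k * (G a t n j * G′ j k)                           ∎

    hypothesis : ∀ k → ∑ (upTo (suc n)) (λ j → C a b n k * (G a t n j * G′ j k)) ≈ C a b n k * G a b n k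
    hypothesis k = trans (∑-*ˡ (C a b n k) (upTo (suc n))) (*-congˡ (composition a b t n k))

    recurrence : ∀ k → ∑ (upTo (suc n)) (λ j → G a t n j * (G′ (suc j) k + C a t n j * G′ j k)) ≈
                       G a b (suc n) k
    recurrence zero = begin
      ∑ (upTo (suc n)) (λ j → G a t n j * (G′ (suc j) 0 + C a t n j * G′ j 0))
        ≈⟨ ∑-cong (All.universal (λ j →
             trans (*-congˡ (+-congʳ (𝒢-suc-zero (- t) b j r))) (collect j 0)) (upTo (suc n))) ⟩
      ∑ (upTo (suc n)) (λ j → C a b n 0 * (G a t n j * G′ j 0))
        ≈⟨ hypothesis 0 ⟩
      C a b n 0 * G a b n 0
        ≈⟨ 𝒢-suc-zero a b n r ⟨
      G a b (suc n) 0 ∎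
    recurrence (suc k) = begin
      ∑ (upTo (suc n)) (λ j → G a t n j * (G′ (suc j) (suc k) + C a t n j * G′ j (suc k)))
        ≈⟨ ∑-cong (All.universal (λ j →
             trans (*-congˡ (trans (+-congʳ (𝒢-suc-suc (- t) b j k r)) (+-assoc _ _ _)))
               (trans (distribˡ _ _ _) (+-congˡ (collect j (suc k))))) (upTo (suc n))) ⟩
      ∑ (upTo (suc n)) (λ j → G a t n j * G′ j k + C a b n (suc k) * (G a t n j * G′ j (suc k)))
        ≈⟨ ∑-+ (upTo (suc n)) ⟩
      ∑ (upTo (suc n)) (λ j → G a t n j * G′ j k) +
      ∑ (upTo (suc n)) (λ j → C a b n (suc k) * (G a t n j * G′ j (suc k)))
        ≈⟨ +-cong (composition a b t n k) (hypothesis (suc k)) ⟩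
      G a b n k + C a b n (suc k) * G a b n (suc k)
        ≈⟨ 𝒢-suc-suc a b n k r ⟨
      G a b (suc n) (suc k) ∎

  -- On the diagonal the coefficient is a multiple of `a` plus the same multiple of `- a`; elsewhere
  -- `δ` is zero.
  C*δ≈0 : ∀ a n k → C a (- a) n k * δ n k ≈ 0#
  C*δ≈0 a n k with n ≟ k
  ... | yes ≡.refl = trans (*-congʳ (trans (+-comm _ _) (n·-‿inverse (n +ℕ r) a))) (zeroˡ _)
  ... | no  n≢k rewrite dec-false (n ≟ k) n≢k = zeroʳ _

  G-δ : ∀ a n k → G a (- a) n k ≈ δ n k
  G-δ a zero    zero    = 𝒢-zero-zero a (- a) r
  G-δ a zero    (suc k) = 𝒢-zero-suc a (- a) k r
  G-δ a (suc n) zero    = begin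
    G a (- a) (suc n) 0            ≈⟨ 𝒢-suc-zero a (- a) n r ⟩
    C a (- a) n 0 * G a (- a) n 0  ≈⟨ *-congˡ (G-δ a n 0) ⟩
    C a (- a) n 0 * δ n 0          ≈⟨ C*δ≈0 a n 0 ⟩
    0#                             ∎
  G-δ a (suc n) (suc k) = begin
    G a (- a) (suc n) (suc k)                                  ≈⟨ 𝒢-suc-suc a (- a) n k r ⟩
    G a (- a) n k + C a (- a) n (suc k) * G a (- a) n (suc k)  ≈⟨ +-cong (G-δ a n k) (*-congˡ (G-δ a n (suc k))) ⟩
    δ n k + C a (- a) n (suc k) * δ n (suc k)                  ≈⟨ +-congˡ (C*δ≈0 a n (suc k)) ⟩
    δ n k + 0#                                                 ≈⟨ +-identityʳ _ ⟩
    -- The comparison of `suc n` with `suc k` computes to that of `n` with `k`, so this is already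
    -- `δ (suc n) (suc k)`.
    δ n k                                                      ∎

  -- Negating both parameters

  sign : ℕ → Carrier
  sign n = (- 1#) ^ n

  -- The coefficient is linear in the parameters, so each factor of it costs one more sign.
  C-negate : ∀ u v n k d y → C (- u) (- v) n k * (sign d * y) ≈ sign (suc d) * (C u v n k * y)
  C-negate u v n k d y = begin
    C (- u) (- v) n k * (sign d * y)    ≈⟨ *-congʳ (trans (+-cong (n·-‿distrib (n +ℕ r) u) (n·-‿distrib (k +ℕ r) v)) (-‿+-comm _ _)) ⟩
    - C u v n k * (sign d * y)          ≈⟨ *-congʳ (-1*x≈-x _) ⟨
    - 1# * C u v n k * (sign d * y)     ≈⟨ *-interchange _ _ _ _ ⟩
    sign (suc d) * (C u v n k * y)      ∎

  -- Homogeneity of degree `n ∸ k`: in the recurrence, raising `n` and `k` together keeps the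
  -- degree, and raising `n` alone brings in one linear coefficient.
  G-negate : ∀ u v n k → G (- u) (- v) n k ≈ sign (n ∸ k) * G u v n k
  G-negate u v zero zero = begin
    G (- u) (- v) 0 0  ≈⟨ 𝒢-zero-zero (- u) (- v) r ⟩
    1#                 ≈⟨ 𝒢-zero-zero u v r ⟨
    G u v 0 0          ≈⟨ *-identityˡ _ ⟨
    1# * G u v 0 0     ∎
  G-negate u v zero (suc k) = trans (G-vanishes 0 (suc k) z<s)
    (sym (trans (*-congˡ (G-vanishes 0 (suc k) z<s)) (zeroʳ _)))
  G-negate u v (suc n) zero = begin
    G (- u) (- v) (suc n) 0                    ≈⟨ 𝒢-suc-zero (- u) (- v) n r ⟩
    C (- u) (- v) n 0 * G (- u) (- v) n 0      ≈⟨ *-congˡ (G-negate u v n 0) ⟩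
    C (- u) (- v) n 0 * (sign n * G u v n 0)   ≈⟨ C-negate u v n 0 n _ ⟩
    sign (suc n) * (C u v n 0 * G u v n 0)     ≈⟨ *-congˡ (𝒢-suc-zero u v n r) ⟨
    sign (suc n) * G u v (suc n) 0             ∎
  G-negate u v (suc n) (suc k) = begin
    G (- u) (- v) (suc n) (suc k)
      ≈⟨ 𝒢-suc-suc (- u) (- v) n k r ⟩
    G (- u) (- v) n k + C (- u) (- v) n (suc k) * G (- u) (- v) n (suc k)
      ≈⟨ +-cong (G-negate u v n k) shifted ⟩
    sign (n ∸ k) * G u v n k + sign (n ∸ k) * (C u v n (suc k) * G u v n (suc k))
      ≈⟨ distribˡ _ _ _ ⟨
    sign (n ∸ k) * (G u v n k + C u v n (suc k) * G u v n (suc k))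
      ≈⟨ *-congˡ (𝒢-suc-suc u v n k r) ⟨
    sign (n ∸ k) * G u v (suc n) (suc k) ∎
    where
    shifted : C (- u) (- v) n (suc k) * G (- u) (- v) n (suc k) ≈
              sign (n ∸ k) * (C u v n (suc k) * G u v n (suc k))
    -- The equation `n ∸ k = suc (n ∸ suc k)` requires `k < n`. Otherwise `G u v n (suc k)` lies
    -- above the diagonal and both sides vanish.
    shifted with k <? n
    ... | yes k<n = begin
      C (- u) (- v) n (suc k) * G (- u) (- v) n (suc k)                 ≈⟨ *-congˡ (G-negate u v n (suc k)) ⟩
      C (- u) (- v) n (suc k) * (sign (n ∸ suc k) * G u v n (suc k))    ≈⟨ C-negate u v n (suc k) (n ∸ suc k) (G u v n (suc k)) ⟩
      sign (suc (n ∸ suc k)) * (C u v n (suc k) * G u v n (suc k))      ≡⟨ cong (λ d → sign d * (C u v n (suc k) * G u v n (suc k))) (≡.sym (+-∸-assoc 1 k<n)) ⟩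
      sign (n ∸ k) * (C u v n (suc k) * G u v n (suc k))                ∎
    ... | no k≮n = trans (vanish (- u) (- v))
                     (sym (trans (*-congˡ (vanish u v)) (zeroʳ _)))
      where
      vanish : ∀ u v → C u v n (suc k) * G u v n (suc k) ≈ 0#
      vanish u v = trans (*-congˡ (G-vanishes n (suc k) (s≤s (≮⇒≥ k≮n)))) (zeroʳ _)

  -- The two identities over `[ k ⋯ n ]`

  interval-composition : ∀ a b t n k → k ≤ n →
    ∑ [ k ⋯ n ] (λ j → G a t n j * G (- t) b j k) ≈ G a b n k
  interval-composition a b t n k k≤n = trans
    (∑-interval k n k≤n (λ j j<k → trans (*-congˡ (G-vanishes j k j<k)) (zeroʳ _)))
    (composition a b t n k)

  orthogonality : ∀ a b n k → k ≤ n →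
    ∑ [ k ⋯ n ] (λ j → sign (j ∸ k) * G a b n j * G b a j k) ≈ δ n k
  orthogonality a b n k k≤n = begin
    ∑ [ k ⋯ n ] (λ j → sign (j ∸ k) * G a b n j * G b a j k)    ≈⟨ ∑-cong (All.universal (λ j → move j) [ k ⋯ n ]) ⟩
    -- This is the composition with `b` as the middle parameter and `- a` as the last one.
    ∑ [ k ⋯ n ] (λ j → G a b n j * G (- b) (- a) j k)           ≈⟨ interval-composition a (- a) b n k k≤n ⟩
    G a (- a) n k                                               ≈⟨ G-δ a n k ⟩
    δ n k                                                       ∎
    where
    move : ∀ j → sign (j ∸ k) * G a b n j * G b a j k ≈ G a b n j * G (- b) (- a) j k
    move j = begin
      sign (j ∸ k) * G a b n j * G b a j k    ≈⟨ *-congʳ (*-comm _ _) ⟩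
      G a b n j * sign (j ∸ k) * G b a j k    ≈⟨ *-assoc _ _ _ ⟩
      G a b n j * (sign (j ∸ k) * G b a j k)  ≈⟨ *-congˡ (G-negate b a j k) ⟨
      G a b n j * G (- b) (- a) j k           ∎

theorem3p2 : ∀ {c ℓ} (R : CommutativeRing c ℓ) →
    let open CommutativeRing R
        open GeneralizedLah R
    in (a b t : Carrier) (n k r : ℕ) → k ≤ n →
       (δ n k ≈ ∑[ j ∈ [ k ⋯ n ] ] ((- 1#) ^ (j ∸ k) * 𝒢 a b n j r * 𝒢 b a j k r))
       × (𝒢 a b n k r ≈ ∑[ j ∈ [ k ⋯ n ] ] (𝒢 a t n j r * 𝒢 (- t) b j k r))
theorem3p2 R a b t n k r k≤n = sym (orthogonality a b n k k≤n) , sym (interval-composition a b t n k k≤n)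
  where
  open CommutativeRing R using (sym)
  open Inversion R r
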